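{- Let $P$ be a set of $n\geq 3$ points in general position in the plane, let $D(P)$ be its edge disjointness graph, and let $\kappa(n):=\binom{\lfloor\frac{n-2}{2}\rfloor}{2}+\binom{\lceil\frac{n-2}{2}\rceil}{2}$. Then $\delta(D(P))\geq \kappa(n)$ and $\Delta(D(P))=\binom{n-2}{2}$. If additionally $P$ is in convex position, then $\delta(D(P))=\kappa(n)$.
   Context: A point set in the plane is in general position if no three of its points are collinear. It is in convex position if all of its points lie on the boundary of its convex hull. The edge disjointness graph $D(P)$ is the graph whose vertices are all the closed straight line segments $xy$ with distinct endpoints $x,y\in P$; two vertices are adjacent if and only if the corresponding segments are disjoint. $\delta(H)$ and $\Delta(H)$ denote the minimum and maximum degree of a graph $H$. By convention $\binom{m}{2}=0$ if $m<2$. -}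

module Defs where

open import Algebra.Bundles using (CommutativeRing)
import Algebra.Properties.Monoid.Sum as MonoidSum
open import Data.Fin.Base using (Fin)
import Data.Fin.Base as Fin
open import Data.List.Base using (length)
open import Data.List.Membership.Propositional using () renaming (_∈_ to _∈ₗ_)
open import Data.List.Relation.Unary.Unique.Propositional using (Unique)
open import Data.Nat.Base using (ℕ; _∸_; ⌊_/2⌋; ⌈_/2⌉)
import Data.Nat.Base as ℕ
open import Data.Nat.Combinatorics using (_C_)
open import Data.Product.Base using (∃-syntax; _×_; _,_; proj₁; proj₂; swap)
open import Data.Product.Relation.Binary.Pointwise.NonDependent using (Pointwise)
open import Data.Sum.Base using (inj₁; inj₂)
open import Data.Vec.Functional using (Vector)
open import Function.Base using (_∘_)
open import Function.Bundles using (_⇔_)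
open import Function.Definitions using (Injective)
open import Level using (suc; _⊔_)
open import Relation.Binary.Core using (Rel)
import Relation.Binary.Construct.StrictToNonStrict as StrictToNonStrict
open import Relation.Binary.Definitions using (Irreflexive; Symmetric)
open import Relation.Binary.PropositionalEquality.Core using (_≡_; _≢_; refl)
open import Relation.Binary.Structures using (IsStrictTotalOrder)
open import Relation.Nullary.Negation.Core using (¬_)
open import Relation.Unary using (Pred; _∈_; _∉_; _⊥_)

-- C(m,2) is `m C 2` from the standard library, which is 0 for m < 2.
κ : ℕ → ℕ
κ n = ⌊ n ∸ 2 /2⌋ C 2 ℕ.+ ⌈ n ∸ 2 /2⌉ C 2

record Graph v e : Set (suc (v ⊔ e)) where
  field
    Vertex : Set v
    Adj    : Rel Vertex e
    sym    : Symmetric Adj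
    irrefl : Irreflexive _≡_ Adj

module _ {v e} (G : Graph v e) where
  open Graph G

  -- The neighbours of u, listed without repetition, number k.  Such a k is
  -- unique when it exists.  Adjacency is not assumed decidable, so degrees,
  -- and with them δ and Δ, are relations rather than functions.
  Degree : Vertex → ℕ → Set (v ⊔ e)
  Degree u k = ∃[ ns ] Unique ns × (∀ w → w ∈ₗ ns ⇔ Adj u w) × length ns ≡ k

  -- δ(G) = d.  That every vertex has a degree is part of the claim.
  MinDegree : ℕ → Set (v ⊔ e)
  MinDegree d = (∃[ u ] Degree u d) × (∀ u → ∃[ k ] Degree u k × d ℕ.≤ k)

  -- Δ(G) = d.
  MaxDegree : ℕ → Set (v ⊔ e)
  MaxDegree d = (∃[ u ] Degree u d) × (∀ u → ∃[ k ] Degree u k × k ℕ.≤ d)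

-- The standard library has no real numbers.  The plane is taken over an
-- arbitrary ordered field; classically ℝ is one.
record OrderedField c ℓ₁ ℓ₂ : Set (suc (c ⊔ ℓ₁ ⊔ ℓ₂)) where
  infix 4 _<_
  field
    commutativeRing : CommutativeRing c ℓ₁
  open CommutativeRing commutativeRing public
  field
    _<_                : Rel Carrier ℓ₂
    isStrictTotalOrder : IsStrictTotalOrder _≈_ _<_
    0<1                : 0# < 1#
    +-monoˡ-<          : ∀ z {x y} → x < y → x + z < y + z
    *-pos              : ∀ {x y} → 0# < x → 0# < y → 0# < x * y
    inverse            : ∀ x → ¬ x ≈ 0# → ∃[ y ] x * y ≈ 1#

  open StrictToNonStrict _≈_ _<_ public using (_≤_)
  open MonoidSum +-monoid public using (sum)

module Plane {c ℓ₁ ℓ₂} (F : OrderedField c ℓ₁ ℓ₂) where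
  open OrderedField F hiding (refl; sym)

  Point : Set c
  Point = Carrier × Carrier

  infix 4 _≈ₚ_
  _≈ₚ_ : Rel Point ℓ₁
  _≈ₚ_ = Pointwise _≈_ _≈_

  Collinear : Point → Point → Point → Set (c ⊔ ℓ₁)
  Collinear p q r = ∃[ a ] ∃[ b ] ∃[ k ]
    ¬ (a ≈ 0# × b ≈ 0#) × OnLine a b k p × OnLine a b k q × OnLine a b k r
    where
    OnLine : Carrier → Carrier → Carrier → Point → Set ℓ₁
    OnLine a b k (x , y) = a * x + b * y ≈ k

  Segment : Point → Point → Pred Point (c ⊔ ℓ₁ ⊔ ℓ₂)
  Segment (x₁ , y₁) (x₂ , y₂) z = ∃[ t ] 0# ≤ t × t ≤ 1# ×
    z ≈ₚ ((1# - t) * x₁ + t * x₂ , (1# - t) * y₁ + t * y₂)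

  Boundary : ∀ {ℓ} → Pred Point ℓ → Pred Point (c ⊔ ℓ₂ ⊔ ℓ)
  Boundary S x = ∀ ε → 0# < ε →
    (∃[ y ] y ∈ Ball x ε × y ∈ S) × (∃[ z ] z ∈ Ball x ε × z ∉ S)
    where
    Ball : Point → Carrier → Pred Point ℓ₂
    Ball (x₁ , x₂) r (y₁ , y₂) =
      (y₁ - x₁) * (y₁ - x₁) + (y₂ - x₂) * (y₂ - x₂) < r * r

  -- An n-element set of points, given by an enumeration without repetition.
  record PointSet (n : ℕ) : Set (c ⊔ ℓ₁) where
    field
      point    : Vector Point n
      distinct : Injective _≡_ _≈ₚ_ point

  module _ {n} (P : PointSet n) where
    open PointSet P

    GeneralPosition : Set (c ⊔ ℓ₁)
    GeneralPosition = ∀ i j k → i ≢ j → i ≢ k → j ≢ k →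
      ¬ Collinear (point i) (point j) (point k)

    ConvexHull : Pred Point (c ⊔ ℓ₁ ⊔ ℓ₂)
    ConvexHull z = ∃[ w ] (∀ i → 0# ≤ w i) × sum w ≈ 1# ×
      z ≈ₚ ( sum (λ i → w i * proj₁ (point i))
           , sum (λ i → w i * proj₂ (point i)) )

    ConvexPosition : Set (c ⊔ ℓ₁ ⊔ ℓ₂)
    ConvexPosition = ∀ i → point i ∈ Boundary ConvexHull

  -- An unordered pair of distinct indices.  A segment determines its
  -- endpoints, so these index the segments of a point set bijectively.
  record Pair (n : ℕ) : Set where
    constructor pair
    field
      lo hi  : Fin n
      .lo<hi : lo Fin.< hi

  module _ {n} (P : PointSet n) where
    open PointSet P

    segment : Pair n → Pred Point (c ⊔ ℓ₁ ⊔ ℓ₂)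
    segment (pair i j _) = Segment (point i) (point j)

    left-endpoint : ∀ e → point (Pair.lo e) ∈ segment e
    left-endpoint e =
      0# , inj₂ (OrderedField.refl F) , inj₁ 0<1 , eq _ _ , eq _ _
      where
      open import Relation.Binary.Reasoning.Setoid setoid
      open import Algebra.Properties.Ring ring using (-0#≈0#)
      eq : ∀ x y → x ≈ (1# - 0#) * x + 0# * y
      eq x y = begin
        x                         ≈⟨ *-identityˡ x ⟨
        1# * x                    ≈⟨ *-congʳ (+-identityʳ 1#) ⟨
        (1# + 0#) * x             ≈⟨ *-congʳ (+-congˡ -0#≈0#) ⟨
        (1# - 0#) * x             ≈⟨ +-identityʳ _ ⟨
        (1# - 0#) * x + 0#        ≈⟨ +-congˡ (zeroˡ y) ⟨
        (1# - 0#) * x + 0# * y    ∎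

    D : Graph _ _
    D = record
      { Vertex = Pair n
      ; Adj    = λ e f → segment e ⊥ segment f
      ; sym    = λ e⊥f → e⊥f ∘ swap
      ; irrefl = λ { {e} refl e⊥e → e⊥e (left-endpoint e , left-endpoint e) }
      }

{-# OPTIONS --safe #-}

-- The line of an edge e = xy splits the other n - 2 points into sets of sizes a
-- and b.  Edges within one of these sets are disjoint from e, whence
-- deg e ≥ C(a,2) + C(b,2) ≥ κ(n), and edges through x or y are not, whence
-- deg e ≤ C(n-2,2).  In convex position every edge between the two sets crosses
-- e, since otherwise one of the four endpoints would be inside the triangle of
-- the others, hence interior to the convex hull; so deg e = C(a,2) + C(b,2).
-- The edges at the lexicographically least point, sorted by angle, realise every
-- split (a, b): a = 0 gives the maximum degree, and a = ⌊(n-2)/2⌋ gives κ(n).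
module Submission where

open import Defs

open import Algebra.Bundles using (CommutativeRing)
import Algebra.Properties.AbelianGroup as AbelianGroupProperties
import Algebra.Properties.CommutativeMonoid.Sum as CommutativeMonoidSum
import Algebra.Properties.Ring as RingProperties
import Algebra.Properties.Semiring.Mult.TCOptimised as SemiringMult
import Algebra.Properties.Semiring.Sum as SemiringSum
import Algebra.Solver.Ring as RingSolver
import Algebra.Solver.Ring.AlmostCommutativeRing as ACR
open import Data.Empty using (⊥-elim)
open import Data.Fin.Base using (Fin; zero; suc)
open import Data.Integer.Base as ℤ using (ℤ; -[1+_]; +0; +[1+_]; _⊖_; _◃_)
import Data.Integer.Properties as ℤ
open import Data.Maybe.Base as Maybe using (Maybe)
import Data.Nat.Base as ℕ
open import Data.Product.Base using (∃-syntax; _×_; _,_; proj₁; proj₂)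
open import Data.Sign.Base as Sign using (Sign)
open import Data.Sum.Base as Sum using (_⊎_; inj₁; inj₂)
open import Data.Vec.Functional using (Vector)
open import Relation.Binary.Definitions using (Decidable; DecidableEquality; tri<; tri≈; tri>)
open import Relation.Binary.PropositionalEquality using (_≡_; _≢_)
import Relation.Binary.PropositionalEquality as ≡
open import Relation.Binary.Structures using (IsStrictTotalOrder)
open import Relation.Nullary.Decidable
  using (Dec; yes; no; recompute; map′; _×-dec_; ¬?; dec⇒maybe)
open import Relation.Nullary.Negation using (¬_)
open import Relation.Unary using (_∈_; _⊥_)

-- Over an arbitrary ordered field there are no limits, angles or square roots, so the geometry is
-- reduced to signs of the orientation determinant `det` and to polynomial identities between
-- determinants. General position makes the sign nonzero for three distinct points, and then the
-- signs decide whether two segments meet. This decision is required even for the plain lower bound: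
-- a degree is witnessed by a list of neighbours, which is obtained by filtering all edges.
--
-- If c and d are on opposite sides of ab, there are four patterns for the sides of a and b with
-- respect to cd. One contradicts an identity, one gives an explicit crossing point, and in the
-- other two the segments are disjoint and one of a, b lies in a triangle. The same analysis thus
-- serves the decision and the convex case.
--
-- Lying to the left as seen from a base point is in general a cyclic relation. It becomes
-- transitive once all other points lie on one side of a line through the base point, ties on that
-- line being broken consistently; this is what the lexicographic minimum provides.

-- Integer coefficients for the ring solver

-- Identities in an abstract commutative ring, solved with integer
-- coefficients: without a zero test on the carrier, the solver has to be
-- told that terms such as x - x cancel.
module IntegerCoefficients {c ℓ} (R : CommutativeRing c ℓ) where
  open CommutativeRing R
  open AbelianGroupProperties +-abelianGroup
    using (⁻¹-∙-comm; ⁻¹-involutive; ε⁻¹≈ε)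
  open RingProperties ring using (-‿distribˡ-*; -‿distribʳ-*)
  open SemiringMult semiring using (1+×; ×-homo-+; ×1-homo-*) renaming (_×_ to _·_)
  open import Relation.Binary.Reasoning.Setoid setoid

  -- The canonical homomorphism from the integers. The optimised multiple makes `1 · 1#` equal to
  -- `1#` by definition, so that `:1` in a polynomial matches `1#` in a goal; the price is that
  -- successor steps go through `1+×`.
  ⟦_⟧ : ℤ → Carrier
  ⟦ ℤ.+ n ⟧    = n · 1#
  ⟦ -[1+ n ] ⟧ = - (ℕ.suc n · 1#)

  signed : Sign → Carrier → Carrier
  signed Sign.+ x = x
  signed Sign.- x = - x

  signed-cong : ∀ s {x y} → x ≈ y → signed s x ≈ signed s y
  signed-cong Sign.+ x≈y = x≈y
  signed-cong Sign.- x≈y = -‿cong x≈y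

  signed-* : ∀ s t x y → signed (s Sign.* t) (x * y) ≈ signed s x * signed t y
  signed-* Sign.+ Sign.+ x y = refl
  signed-* Sign.+ Sign.- x y = -‿distribʳ-* x y
  signed-* Sign.- Sign.+ x y = -‿distribˡ-* x y
  signed-* Sign.- Sign.- x y = begin
    x * y          ≈⟨ ⁻¹-involutive _ ⟨
    - - (x * y)    ≈⟨ -‿cong (-‿distribʳ-* x y) ⟩
    - (x * - y)    ≈⟨ -‿distribˡ-* x (- y) ⟩
    - x * - y      ∎

  ⟦◃⟧ : ∀ s n → ⟦ s ◃ n ⟧ ≈ signed s (n · 1#)
  ⟦◃⟧ Sign.+ ℕ.zero    = refl
  ⟦◃⟧ Sign.- ℕ.zero    = sym ε⁻¹≈ε
  ⟦◃⟧ Sign.+ (ℕ.suc n) = refl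
  ⟦◃⟧ Sign.- (ℕ.suc n) = refl

  ⟦⟧≈signed : ∀ i → ⟦ i ⟧ ≈ signed (ℤ.sign i) (ℤ.∣ i ∣ · 1#)
  ⟦⟧≈signed (ℤ.+ n)    = refl
  ⟦⟧≈signed (-[1+ n ]) = refl

  *-homo : ∀ i j → ⟦ i ℤ.* j ⟧ ≈ ⟦ i ⟧ * ⟦ j ⟧
  *-homo i j = begin
    ⟦ i ℤ.* j ⟧
      ≈⟨ ⟦◃⟧ (ℤ.sign i Sign.* ℤ.sign j) (ℤ.∣ i ∣ ℕ.* ℤ.∣ j ∣) ⟩
    signed (ℤ.sign i Sign.* ℤ.sign j) ((ℤ.∣ i ∣ ℕ.* ℤ.∣ j ∣) · 1#)
      ≈⟨ signed-cong (ℤ.sign i Sign.* ℤ.sign j) (×1-homo-* ℤ.∣ i ∣ ℤ.∣ j ∣) ⟩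
    signed (ℤ.sign i Sign.* ℤ.sign j) (ℤ.∣ i ∣ · 1# * ℤ.∣ j ∣ · 1#)
      ≈⟨ signed-* (ℤ.sign i) (ℤ.sign j) _ _ ⟩
    signed (ℤ.sign i) (ℤ.∣ i ∣ · 1#) * signed (ℤ.sign j) (ℤ.∣ j ∣ · 1#)
      ≈⟨ *-cong (⟦⟧≈signed i) (⟦⟧≈signed j) ⟨
    ⟦ i ⟧ * ⟦ j ⟧ ∎

  -‿homo : ∀ i → ⟦ ℤ.- i ⟧ ≈ - ⟦ i ⟧
  -‿homo +0       = sym ε⁻¹≈ε
  -‿homo +[1+ n ] = refl
  -‿homo -[1+ n ] = sym (⁻¹-involutive _)

  cancel-1 : ∀ x y → (1# + x) - (1# + y) ≈ x - y
  cancel-1 x y = begin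
    (1# + x) - (1# + y)      ≈⟨ +-cong (+-comm 1# x) (sym (⁻¹-∙-comm 1# y)) ⟩
    (x + 1#) + (- 1# - y)    ≈⟨ +-assoc x 1# _ ⟩
    x + (1# + (- 1# - y))    ≈⟨ +-congˡ (+-assoc 1# (- 1#) (- y)) ⟨
    x + ((1# - 1#) - y)      ≈⟨ +-congˡ (+-congʳ (-‿inverseʳ 1#)) ⟩
    x + (0# - y)             ≈⟨ +-congˡ (+-identityˡ (- y)) ⟩
    x - y                    ∎

  ⊖-homo : ∀ m n → ⟦ m ⊖ n ⟧ ≈ m · 1# - n · 1#
  ⊖-homo ℕ.zero ℕ.zero    = sym (-‿inverseʳ 0#)
  ⊖-homo ℕ.zero (ℕ.suc n) = sym (+-identityˡ _)
  ⊖-homo (ℕ.suc m) ℕ.zero = sym (trans (+-congˡ ε⁻¹≈ε) (+-identityʳ _))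
  ⊖-homo (ℕ.suc m) (ℕ.suc n) = begin
    ⟦ ℕ.suc m ⊖ ℕ.suc n ⟧               ≡⟨ ≡.cong ⟦_⟧ (ℤ.[1+m]⊖[1+n]≡m⊖n m n) ⟩
    ⟦ m ⊖ n ⟧                           ≈⟨ ⊖-homo m n ⟩
    m · 1# - n · 1#                     ≈⟨ cancel-1 _ _ ⟨
    (1# + m · 1#) - (1# + n · 1#)       ≈⟨ +-cong (1+× m 1#) (-‿cong (1+× n 1#)) ⟨
    ℕ.suc m · 1# - ℕ.suc n · 1#         ∎

  +-homo : ∀ i j → ⟦ i ℤ.+ j ⟧ ≈ ⟦ i ⟧ + ⟦ j ⟧
  +-homo (ℤ.+ m)  (ℤ.+ n)  = ×-homo-+ 1# m n
  +-homo (ℤ.+ m)  -[1+ n ] = ⊖-homo m (ℕ.suc n)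
  +-homo -[1+ m ] (ℤ.+ n)  = trans (⊖-homo n (ℕ.suc m)) (+-comm _ _)
  +-homo -[1+ m ] -[1+ n ] = begin
    - (ℕ.suc (ℕ.suc (m ℕ.+ n)) · 1#)
      ≈⟨ -‿cong (1+× (ℕ.suc (m ℕ.+ n)) 1#) ⟩
    - (1# + ℕ.suc (m ℕ.+ n) · 1#)
      ≈⟨ -‿cong (+-congˡ (×-homo-+ 1# (ℕ.suc m) n)) ⟩
    - (1# + (ℕ.suc m · 1# + n · 1#))
      ≈⟨ -‿cong (trans (sym (+-assoc _ _ _)) (trans (+-congʳ (+-comm _ _)) (+-assoc _ _ _))) ⟩
    - (ℕ.suc m · 1# + (1# + n · 1#))
      ≈⟨ -‿cong (+-congˡ (1+× n 1#)) ⟨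
    - (ℕ.suc m · 1# + ℕ.suc n · 1#)
      ≈⟨ ⁻¹-∙-comm _ _ ⟨
    - (ℕ.suc m · 1#) - ℕ.suc n · 1# ∎

  homomorphism : ℤ.+-*-rawRing ACR.-Raw-AlmostCommutative⟶ ACR.fromCommutativeRing R
  homomorphism = record
    { ⟦_⟧    = ⟦_⟧
    ; +-homo = +-homo
    ; *-homo = *-homo
    ; -‿homo = -‿homo
    ; 0-homo = refl
    ; 1-homo = refl
    }

  -- A one-sided test suffices for normalisation; distinct integers may have equal images in `R`.
  _≟_ : ∀ i j → Maybe (⟦ i ⟧ ≈ ⟦ j ⟧)
  i ≟ j = Maybe.map (λ i≡j → reflexive (≡.cong ⟦_⟧ i≡j)) (dec⇒maybe (i ℤ.≟ j))

  open RingSolver ℤ.+-*-rawRing (ACR.fromCommutativeRing R) homomorphism _≟_ public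
    using (Polynomial; solve; _:=_; _:+_; _:*_; _:-_; :-_; con)

  :0 :1 : ∀ {m} → Polynomial m
  :0 = con +0
  :1 = con +[1+ 0 ]

-- Signs and inequalities in an ordered field

module OrderedFieldProperties {c ℓ₁ ℓ₂} (F : OrderedField c ℓ₁ ℓ₂) where
  open OrderedField F
  open IntegerCoefficients commutativeRing using (:1; solve; _:=_; _:+_; _:*_; _:-_; :-_)
  open IsStrictTotalOrder isStrictTotalOrder public
    using (compare; _<?_; <-resp-≈) renaming (trans to <-trans; irrefl to <-irrefl)

  pos-resp : ∀ {x y} → x ≈ y → 0# < x → 0# < y
  pos-resp = proj₁ <-resp-≈

  diff-pos : ∀ {x y} → x < y → 0# < y - x
  diff-pos {x} {y} x<y = proj₂ <-resp-≈ (-‿inverseʳ x) (+-monoˡ-< (- x) x<y)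

  diff-pos⁻ : ∀ {x y} → 0# < y - x → x < y
  diff-pos⁻ {x} {y} p = proj₂ <-resp-≈ (+-identityˡ x)
    (proj₁ <-resp-≈ (solve 2 (λ x y → (y :- x) :+ x := y) refl x y) (+-monoˡ-< x p))

  +-pos : ∀ {x y} → 0# < x → 0# < y → 0# < x + y
  +-pos {x} {y} 0<x 0<y =
    <-trans 0<y (proj₂ <-resp-≈ (+-identityˡ y) (+-monoˡ-< y 0<x))

  neg-pos : ∀ {x} → x < 0# → 0# < - x
  neg-pos x<0 = pos-resp (+-identityˡ _) (diff-pos x<0)

  sign : ∀ x → 0# < x ⊎ x ≈ 0# ⊎ 0# < - x
  sign x with compare 0# x
  ... | tri< 0<x _ _ = inj₁ 0<x
  ... | tri≈ _ 0≈x _ = inj₂ (inj₁ (sym 0≈x))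
  ... | tri> _ _ x<0 = inj₂ (inj₂ (neg-pos x<0))

  pos⇒≉0 : ∀ {x} → 0# < x → ¬ x ≈ 0#
  pos⇒≉0 0<x x≈0 = <-irrefl (sym x≈0) 0<x

  pos⇒¬neg : ∀ {x} → 0# < x → ¬ 0# < - x
  pos⇒¬neg 0<x 0<-x = pos⇒≉0 (+-pos 0<x 0<-x) (-‿inverseʳ _)

  *-cancel-pos : ∀ {x y} → 0# < x → 0# < x * y → 0# < y
  *-cancel-pos {x} {y} 0<x 0<xy with sign y
  ... | inj₁ 0<y         = 0<y
  ... | inj₂ (inj₁ y≈0)  = ⊥-elim (pos⇒≉0 0<xy (trans (*-congˡ y≈0) (zeroʳ x)))
  ... | inj₂ (inj₂ 0<-y) = ⊥-elim (pos⇒¬neg 0<xy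
    (pos-resp (solve 2 (λ x y → x :* (:- y) := :- (x :* y)) refl x y) (*-pos 0<x 0<-y)))

  pos-inverse : ∀ {x} → 0# < x → ∃[ y ] 0# < y × x * y ≈ 1#
  pos-inverse {x} 0<x with inverse x (pos⇒≉0 0<x)
  ... | y , xy≈1 = y , *-cancel-pos 0<x (pos-resp (sym xy≈1) 0<1) , xy≈1

  *-nonneg : ∀ {x y} → 0# ≤ x → 0# ≤ y → 0# ≤ x * y
  *-nonneg {x} {y} (inj₁ 0<x) (inj₁ 0<y) = inj₁ (*-pos 0<x 0<y)
  *-nonneg {x} {y} (inj₂ 0≈x) _          = inj₂ (sym (trans (*-congʳ (sym 0≈x)) (zeroˡ y)))
  *-nonneg {x} {y} (inj₁ _)   (inj₂ 0≈y) = inj₂ (sym (trans (*-congˡ (sym 0≈y)) (zeroʳ x)))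

  pos+nonneg : ∀ {x y} → 0# < x → 0# ≤ y → 0# < x + y
  pos+nonneg 0<x (inj₁ 0<y) = +-pos 0<x 0<y
  pos+nonneg 0<x (inj₂ 0≈y) = pos-resp (trans (sym (+-identityʳ _)) (+-congˡ 0≈y)) 0<x

  +-nonneg : ∀ {x y} → 0# ≤ x → 0# ≤ y → 0# ≤ x + y
  +-nonneg (inj₁ 0<x) 0≤y        = inj₁ (pos+nonneg 0<x 0≤y)
  +-nonneg (inj₂ 0≈x) (inj₁ 0<y) = inj₁ (pos-resp (trans (sym (+-identityˡ _)) (+-congʳ 0≈x)) 0<y)
  +-nonneg (inj₂ 0≈x) (inj₂ 0≈y) = inj₂ (trans (sym (+-identityˡ 0#)) (+-cong 0≈x 0≈y))

  square-nonneg : ∀ x → 0# ≤ x * x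
  square-nonneg x with sign x
  ... | inj₁ 0<x         = inj₁ (*-pos 0<x 0<x)
  ... | inj₂ (inj₁ x≈0)  = inj₂ (sym (trans (*-congʳ x≈0) (zeroˡ x)))
  ... | inj₂ (inj₂ 0<-x) = inj₁
    (pos-resp (solve 1 (λ x → (:- x) :* (:- x) := x :* x) refl x) (*-pos 0<-x 0<-x))

  convex-pos : ∀ {t x y} → 0# ≤ t → t ≤ 1# → 0# < x → 0# < y → 0# < (1# - t) * x + t * y
  convex-pos {t} {x} {y} 0≤t (inj₁ t<1) 0<x 0<y =
    pos+nonneg (*-pos (diff-pos t<1) 0<x) (*-nonneg 0≤t (inj₁ 0<y))
  convex-pos {t} {x} {y} _ (inj₂ t≈1) _ 0<y = pos-resp (sym eq) 0<y
    where
    eq : (1# - t) * x + t * y ≈ y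
    eq = trans (+-cong (*-congʳ (+-congˡ (-‿cong t≈1))) (*-congʳ t≈1))
      (solve 2 (λ x y → (:1 :- :1) :* x :+ :1 :* y := y) refl x y)

  -- Stands in for taking square roots. The hypothesis is positivity of `(k + w) * (k - w)`; if
  -- `k + w` were negative, then `k - w = 2k - (k + w)` would be positive and the product negative.
  square<square : ∀ {k w} → 0# < k → 0# < k * k - w * w → 0# < k + w
  square<square {k} {w} 0<k 0<k²-w² with sign (k + w)
  ... | inj₁ 0<k+w          = 0<k+w
  ... | inj₂ (inj₁ k+w≈0)   = ⊥-elim (pos⇒≉0 0<k²-w²
    (trans (solve 2 (λ k w → k :* k :- w :* w := (k :+ w) :* (k :- w)) refl k w)
      (trans (*-congʳ k+w≈0) (zeroˡ _))))
  ... | inj₂ (inj₂ 0<-k-w) = ⊥-elim (pos⇒¬neg 0<k²-w²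
    (pos-resp
      (solve 2 (λ k w →
        (:- (k :+ w)) :* ((k :+ k) :+ (:- (k :+ w))) := :- (k :* k :- w :* w)) refl k w)
      (*-pos 0<-k-w (+-pos (+-pos 0<k 0<k) 0<-k-w))))

  -- With s = u² + v², the radius k / (s + 1) works by Cauchy-Schwarz:
  -- (u x + v y)² ≤ s (x² + y²) ≤ s k² / (s + 1)² < k².
  affine-pos-near : ∀ {k} u v → 0# < k → ∃[ ε ] 0# < ε ×
    (∀ x y → x * x + y * y < ε * ε → 0# < k + (u * x + v * y))
  affine-pos-near {k} u v 0<k = ε , *-pos 0<k (proj₁ (proj₂ 1/m)) , near
    where
    s m : Carrier
    s = u * u + v * v
    m = s + 1#
    0≤s : 0# ≤ s
    0≤s = +-nonneg (square-nonneg u) (square-nonneg v)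
    0<m : 0# < m
    0<m = pos-resp (+-comm 1# s) (pos+nonneg 0<1 0≤s)
    1/m = pos-inverse 0<m
    ε : Carrier
    ε = k * proj₁ 1/m
    k≈εm : ε * m ≈ k
    k≈εm = trans (solve 3 (λ k i m → (k :* i) :* m := k :* (m :* i)) refl k (proj₁ 1/m) m)
      (trans (*-congˡ (proj₂ (proj₂ 1/m))) (*-identityʳ k))
    -- Lagrange's identity `(u x + v y)² + (u y - v x)² = s d` combined with
    -- `m² - (s² + s + 1) = s`. It writes the right-hand side as a positive term plus terms that are
    -- visibly nonnegative.
    identity : ∀ ε u v x y → let s = u * u + v * v ; d = x * x + y * y in
      (ε * ε - d) * ((s + 1#) * (s + 1#))
        + (d * (s * s + s + 1#) + (u * y - v * x) * (u * y - v * x))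
        ≈ (ε * (s + 1#)) * (ε * (s + 1#)) - (u * x + v * y) * (u * x + v * y)
    identity = solve 5 (λ ε u v x y →
      let s = u :* u :+ v :* v ; d = x :* x :+ y :* y ; m = s :+ :1 in
      (ε :* ε :- d) :* (m :* m)
        :+ (d :* (s :* s :+ s :+ :1) :+ (u :* y :- v :* x) :* (u :* y :- v :* x))
      := (ε :* m) :* (ε :* m) :- (u :* x :+ v :* y) :* (u :* x :+ v :* y)) refl
    near : ∀ x y → x * x + y * y < ε * ε → 0# < k + (u * x + v * y)
    near x y d<ε² = square<square 0<k (pos-resp
      (trans (identity ε u v x y) (+-congʳ (*-cong k≈εm k≈εm)))
      (pos+nonneg (*-pos (diff-pos d<ε²) (*-pos 0<m 0<m))
        (+-nonneg
          (*-nonneg (+-nonneg (square-nonneg x) (square-nonneg y))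
            (+-nonneg (+-nonneg (square-nonneg s) 0≤s) (inj₁ 0<1)))
          (square-nonneg (u * y - v * x)))))

  square-mono : ∀ {x y} → 0# < x → x < y → x * x < y * y
  square-mono {x} {y} 0<x x<y = diff-pos⁻ (pos-resp
    (solve 2 (λ x y → (y :- x) :* (y :+ x) := y :* y :- x :* x) refl x y)
    (*-pos (diff-pos x<y) (+-pos (<-trans 0<x x<y) 0<x)))

  -- The smaller of two radii. Balls are given by squared distances, so the comparison is passed on
  -- to the squares.
  common-radius : ∀ {ε₁ ε₂} → 0# < ε₁ → 0# < ε₂ →
    ∃[ ε ] 0# < ε × (∀ {d} → d < ε * ε → d < ε₁ * ε₁ × d < ε₂ * ε₂)
  common-radius {ε₁} {ε₂} 0<ε₁ 0<ε₂ with compare ε₁ ε₂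
  ... | tri< ε₁<ε₂ _ _ = ε₁ , 0<ε₁ , λ d< → d< , <-trans d< (square-mono 0<ε₁ ε₁<ε₂)
  ... | tri≈ _ ε₁≈ε₂ _ = ε₁ , 0<ε₁ , λ d< → d< , proj₁ <-resp-≈ (*-cong ε₁≈ε₂ ε₁≈ε₂) d<
  ... | tri> _ _ ε₂<ε₁ = ε₂ , 0<ε₂ , λ d< → <-trans d< (square-mono 0<ε₂ ε₂<ε₁) , d<

-- Orientation, segments and crossings

module PlaneGeometry {c ℓ₁ ℓ₂} (F : OrderedField c ℓ₁ ℓ₂) where
  open OrderedField F
  open OrderedFieldProperties F
  open IntegerCoefficients commutativeRing
    using (Polynomial; :0; :1; solve; _:=_; _:+_; _:*_; _:-_; :-_)
  open Plane F

  -- Twice the signed area of the triangle, positive when its corners are in counterclockwise order.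
  det : Point → Point → Point → Carrier
  det (x₁ , y₁) (x₂ , y₂) (x₃ , y₃) = (x₂ - x₁) * (y₃ - y₁) - (y₂ - y₁) * (x₃ - x₁)

  :det : ∀ {m} → (x₁ y₁ x₂ y₂ x₃ y₃ : Polynomial m) → Polynomial m
  :det x₁ y₁ x₂ y₂ x₃ y₃ = (x₂ :- x₁) :* (y₃ :- y₁) :- (y₂ :- y₁) :* (x₃ :- x₁)

  Left : Point → Point → Point → Set ℓ₂
  Left a b c = 0# < det a b c

  det-rotate : ∀ a b c → det a b c ≈ det b c a
  det-rotate (x₁ , y₁) (x₂ , y₂) (x₃ , y₃) = solve 6 (λ x₁ y₁ x₂ y₂ x₃ y₃ →
    :det x₁ y₁ x₂ y₂ x₃ y₃ := :det x₂ y₂ x₃ y₃ x₁ y₁) refl x₁ y₁ x₂ y₂ x₃ y₃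

  det-swap : ∀ a b c → - det a b c ≈ det b a c
  det-swap (x₁ , y₁) (x₂ , y₂) (x₃ , y₃) = solve 6 (λ x₁ y₁ x₂ y₂ x₃ y₃ →
    :- :det x₁ y₁ x₂ y₂ x₃ y₃ := :det x₂ y₂ x₁ y₁ x₃ y₃) refl x₁ y₁ x₂ y₂ x₃ y₃

  det-degenerate : ∀ a b → det a a b ≈ 0#
  det-degenerate (x₁ , y₁) (x₂ , y₂) = solve 4 (λ x₁ y₁ x₂ y₂ →
    :det x₁ y₁ x₁ y₁ x₂ y₂ := :0) refl x₁ y₁ x₂ y₂

  det-cong₃ : ∀ a b {z w} → z ≈ₚ w → det a b z ≈ det a b w
  det-cong₃ a b (x≈ , y≈) =
    +-cong (*-congˡ (+-congʳ y≈)) (-‿cong (*-congˡ (+-congʳ x≈)))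

  Left-rotate : ∀ a b c → Left a b c → Left b c a
  Left-rotate a b c = pos-resp (det-rotate a b c)

  Left-asym : ∀ a b c → Left a b c → ¬ Left b a c
  Left-asym a b c l r = pos⇒¬neg l (pos-resp (sym (det-swap a b c)) r)

  Left-irrefl : ∀ a b → ¬ Left a a b
  Left-irrefl a b l = pos⇒≉0 l (det-degenerate a b)

  side : ∀ a b c → ¬ det a b c ≈ 0# → Left a b c ⊎ Left b a c
  side a b c det≉0 with sign (det a b c)
  ... | inj₁ l        = inj₁ l
  ... | inj₂ (inj₁ e) = ⊥-elim (det≉0 e)
  ... | inj₂ (inj₂ r) = inj₂ (pos-resp (det-swap a b c) r)

  -- The witness is the line through `a` with normal vector `(y₁ - y₂ , x₂ - x₁)`, which is nonzero
  -- because `a` and `b` differ. Its equation evaluated at `c` is off by exactly `det a b c`.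
  det≈0⇒Collinear : ∀ {a b c} → ¬ a ≈ₚ b → det a b c ≈ 0# → Collinear a b c
  det≈0⇒Collinear {x₁ , y₁} {x₂ , y₂} {x₃ , y₃} a≉b det≈0 =
    y₁ - y₂ , x₂ - x₁ , (y₁ - y₂) * x₁ + (x₂ - x₁) * y₁
    , (λ (p , q) → a≉b (sym (equal q) , equal p))
    , refl
    , solve 4 (λ x₁ y₁ x₂ y₂ → (y₁ :- y₂) :* x₂ :+ (x₂ :- x₁) :* y₂
        := (y₁ :- y₂) :* x₁ :+ (x₂ :- x₁) :* y₁) refl x₁ y₁ x₂ y₂
    , trans
        (solve 6 (λ x₁ y₁ x₂ y₂ x₃ y₃ → (y₁ :- y₂) :* x₃ :+ (x₂ :- x₁) :* y₃
          := :det x₁ y₁ x₂ y₂ x₃ y₃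
             :+ ((y₁ :- y₂) :* x₁ :+ (x₂ :- x₁) :* y₁)) refl x₁ y₁ x₂ y₂ x₃ y₃)
        (trans (+-congʳ det≈0) (+-identityˡ _))
    where
    equal : ∀ {x y} → x - y ≈ 0# → x ≈ y
    equal {x} {y} x-y≈0 =
      trans (solve 2 (λ x y → x := (x :- y) :+ y) refl x y) (trans (+-congʳ x-y≈0) (+-identityˡ y))

  start∈segment : ∀ a b → a ∈ Segment a b
  start∈segment (x₁ , y₁) (x₂ , y₂) = 0# , inj₂ refl , inj₁ 0<1 , eq x₁ x₂ , eq y₁ y₂
    where
    eq = solve 2 (λ x y → x := (:1 :- :0) :* x :+ :0 :* y) refl

  end∈segment : ∀ a b → b ∈ Segment a b
  end∈segment (x₁ , y₁) (x₂ , y₂) = 1# , inj₁ 0<1 , inj₂ refl , eq x₁ x₂ , eq y₁ y₂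
    where
    eq = solve 2 (λ x y → y := (:1 :- :1) :* x :+ :1 :* y) refl

  Segment-sym : ∀ a b {z} → z ∈ Segment a b → z ∈ Segment b a
  Segment-sym (x₁ , y₁) (x₂ , y₂) (t , 0≤t , t≤1 , x≈ , y≈) =
    1# - t , nonneg t≤1 , ≤1 0≤t , trans x≈ (eq t x₁ x₂) , trans y≈ (eq t y₁ y₂)
    where
    nonneg : t ≤ 1# → 0# ≤ 1# - t
    nonneg (inj₁ t<1) = inj₁ (diff-pos t<1)
    nonneg (inj₂ t≈1) = inj₂ (sym (trans (+-congˡ (-‿cong t≈1)) (-‿inverseʳ 1#)))
    ≤1 : 0# ≤ t → 1# - t ≤ 1#
    ≤1 (inj₁ 0<t) = inj₁ (diff-pos⁻
      (pos-resp (solve 1 (λ t → t := :1 :- (:1 :- t)) refl t) 0<t))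
    ≤1 (inj₂ 0≈t) = inj₂
      (trans (+-congˡ (-‿cong (sym 0≈t))) (solve 0 (:1 :- :0 := :1) refl))
    eq = solve 3 (λ t x y → (:1 :- t) :* x :+ t :* y
      := (:1 :- (:1 :- t)) :* y :+ (:1 :- t) :* x) refl

  det-segment : ∀ a b c d t →
    det a b ( (1# - t) * proj₁ c + t * proj₁ d , (1# - t) * proj₂ c + t * proj₂ d )
    ≈ (1# - t) * det a b c + t * det a b d
  det-segment (x₁ , y₁) (x₂ , y₂) (x₃ , y₃) (x₄ , y₄) t =
    solve 9 (λ x₁ y₁ x₂ y₂ x₃ y₃ x₄ y₄ t →
      :det x₁ y₁ x₂ y₂ ((:1 :- t) :* x₃ :+ t :* x₄) ((:1 :- t) :* y₃ :+ t :* y₄)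
      := (:1 :- t) :* :det x₁ y₁ x₂ y₂ x₃ y₃ :+ t :* :det x₁ y₁ x₂ y₂ x₄ y₄)
      refl x₁ y₁ x₂ y₂ x₃ y₃ x₄ y₄ t

  -- `det a b` is affine in its last argument: it vanishes along `ab` and is positive along `cd`, so
  -- a common point would have both values.
  same-side⇒disjoint : ∀ a b c d → Left a b c → Left a b d → Segment a b ⊥ Segment c d
  same-side⇒disjoint a b c d lc ld ((s , 0≤s , s≤1 , z≈ab) , (t , 0≤t , t≤1 , z≈cd)) =
    pos⇒≉0
      (pos-resp (sym (trans (det-cong₃ a b z≈cd) (det-segment a b c d t)))
        (convex-pos 0≤t t≤1 lc ld))
      (trans (trans (det-cong₃ a b z≈ab) (det-segment a b a b s)) on-line)
    where
    on-line : (1# - s) * det a b a + s * det a b b ≈ 0#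
    on-line = trans
      (+-cong (*-congˡ (trans (sym (det-rotate a a b)) (det-degenerate a b)))
        (*-congˡ (trans (det-rotate a b b) (det-degenerate b a))))
      (solve 1 (λ s → (:1 :- s) :* :0 :+ s :* :0 := :0) refl s)

  -- With [abc] = det a b c, the lines meet at parameter [dca] / S on ab and [abc] / S on cd,
  -- with common denominator S = [abc] + [bad] = [cdb] + [dca].
  cross : ∀ a b c d → Left a b c → Left b a d → Left c d b → Left d c a →
    ∃[ z ] (z ∈ Segment a b × z ∈ Segment c d)
  cross a b c d labc lbad lcdb ldca with pos-inverse (+-pos labc lbad)
  ... | i , 0<i , Si≈1 =
    _ , ( E * i , inj₁ (*-pos ldca 0<i) , inj₁ (param<1 E lcdb (S≈E+C a b c d)) , refl , refl )
      , ( A * i , inj₁ (*-pos labc 0<i) , inj₁ (param<1 A lbad refl)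
        , trans (at (proj₁ a) (proj₁ b) E)
            (trans (*-congˡ (meet-x a b c d)) (sym (at (proj₁ c) (proj₁ d) A)))
        , trans (at (proj₂ a) (proj₂ b) E)
            (trans (*-congˡ (meet-y a b c d)) (sym (at (proj₂ c) (proj₂ d) A))) )
    where
    A E S : Carrier
    A = det a b c
    E = det d c a
    S = det a b c + det b a d
    S≈E+C : ∀ a b c d → det a b c + det b a d ≈ det d c a + det c d b
    S≈E+C (x₁ , y₁) (x₂ , y₂) (x₃ , y₃) (x₄ , y₄) =
      solve 8 (λ x₁ y₁ x₂ y₂ x₃ y₃ x₄ y₄ →
        :det x₁ y₁ x₂ y₂ x₃ y₃ :+ :det x₂ y₂ x₁ y₁ x₄ y₄
        := :det x₄ y₄ x₃ y₃ x₁ y₁ :+ :det x₃ y₃ x₄ y₄ x₂ y₂)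
        refl x₁ y₁ x₂ y₂ x₃ y₃ x₄ y₄
    meet-x : ∀ a b c d → let S = det a b c + det b a d in
      (S - det d c a) * proj₁ a + det d c a * proj₁ b
      ≈ (S - det a b c) * proj₁ c + det a b c * proj₁ d
    meet-x (x₁ , y₁) (x₂ , y₂) (x₃ , y₃) (x₄ , y₄) =
      solve 8 (λ x₁ y₁ x₂ y₂ x₃ y₃ x₄ y₄ →
        let A = :det x₁ y₁ x₂ y₂ x₃ y₃
            S = A :+ :det x₂ y₂ x₁ y₁ x₄ y₄
            E = :det x₄ y₄ x₃ y₃ x₁ y₁ in
        (S :- E) :* x₁ :+ E :* x₂ := (S :- A) :* x₃ :+ A :* x₄)
        refl x₁ y₁ x₂ y₂ x₃ y₃ x₄ y₄
    meet-y : ∀ a b c d → let S = det a b c + det b a d in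
      (S - det d c a) * proj₂ a + det d c a * proj₂ b
      ≈ (S - det a b c) * proj₂ c + det a b c * proj₂ d
    meet-y (x₁ , y₁) (x₂ , y₂) (x₃ , y₃) (x₄ , y₄) =
      solve 8 (λ x₁ y₁ x₂ y₂ x₃ y₃ x₄ y₄ →
        let A = :det x₁ y₁ x₂ y₂ x₃ y₃
            S = A :+ :det x₂ y₂ x₁ y₁ x₄ y₄
            E = :det x₄ y₄ x₃ y₃ x₁ y₁ in
        (S :- E) :* y₁ :+ E :* y₂ := (S :- A) :* y₃ :+ A :* y₄)
        refl x₁ y₁ x₂ y₂ x₃ y₃ x₄ y₄
    param<1 : ∀ x {y} → 0# < y → S ≈ x + y → x * i < 1#
    param<1 x {y} 0<y S≈x+y = diff-pos⁻ (pos-resp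
      (trans (solve 3 (λ x y i → y :* i := (x :+ y) :* i :- x :* i) refl x y i)
        (+-congʳ (trans (*-congʳ (sym S≈x+y)) Si≈1)))
      (*-pos 0<y 0<i))
    at : ∀ x y e → (1# - e * i) * x + (e * i) * y ≈ i * ((S - e) * x + e * y)
    at x y e = trans (+-congʳ (*-congʳ (+-congʳ (sym Si≈1))))
      (solve 5 (λ x y e i S → (S :* i :- e :* i) :* x :+ (e :* i) :* y
        := i :* ((S :- e) :* x :+ e :* y)) refl x y e i S)

  -- The left side is the cross product of `b - a` with `c - d`, and the bracket on the right is
  -- that of `d - c` with `a - b`; exchanging the factors changes the sign. This rules out one of
  -- the two ways in which `cd` could separate `a` from `b`.
  det-exchange : ∀ a b c d → det a b c + det b a d ≈ - (det c d a + det d c b)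
  det-exchange (x₁ , y₁) (x₂ , y₂) (x₃ , y₃) (x₄ , y₄) =
    solve 8 (λ x₁ y₁ x₂ y₂ x₃ y₃ x₄ y₄ →
      :det x₁ y₁ x₂ y₂ x₃ y₃ :+ :det x₂ y₂ x₁ y₁ x₄ y₄
      := :- (:det x₃ y₃ x₄ y₄ x₁ y₁ :+ :det x₄ y₄ x₃ y₃ x₂ y₂))
      refl x₁ y₁ x₂ y₂ x₃ y₃ x₄ y₄

  ¬cross-reversed : ∀ a b c d → Left a b c → Left b a d → Left c d a → ¬ Left d c b
  ¬cross-reversed a b c d labc lbad lcda ldcb =
    pos⇒¬neg (+-pos lcda ldcb) (pos-resp (det-exchange a b c d) (+-pos labc lbad))

  det-shift : ∀ a b z y →
    det a b z +
      ((proj₂ a - proj₂ b) * (proj₁ y - proj₁ z) + (proj₁ b - proj₁ a) * (proj₂ y - proj₂ z))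
    ≈ det a b y
  det-shift (x₁ , y₁) (x₂ , y₂) (x₃ , y₃) (x₄ , y₄) =
    solve 8 (λ x₁ y₁ x₂ y₂ x₃ y₃ x₄ y₄ →
      :det x₁ y₁ x₂ y₂ x₃ y₃ :+ ((y₁ :- y₂) :* (x₄ :- x₃) :+ (x₂ :- x₁) :* (y₄ :- y₃))
      := :det x₁ y₁ x₂ y₂ x₄ y₄)
      refl x₁ y₁ x₂ y₂ x₃ y₃ x₄ y₄

  -- Open half-planes are open in the sense of the balls in `Boundary`: `det-shift` displays
  -- `det a b` as an affine function of the displacement from `z`.
  Left-near : ∀ a b z → Left a b z → ∃[ ε ] 0# < ε ×
    (∀ y →
      (proj₁ y - proj₁ z) * (proj₁ y - proj₁ z) + (proj₂ y - proj₂ z) * (proj₂ y - proj₂ z) < ε * ε →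
      Left a b y)
  Left-near a b z l =
    let (ε , 0<ε , near) = affine-pos-near (proj₂ a - proj₂ b) (proj₁ b - proj₁ a) l
    in ε , 0<ε , λ y y∈ball →
      pos-resp (det-shift a b z y) (near (proj₁ y - proj₁ z) (proj₂ y - proj₂ z) y∈ball)

  InTriangle : Point → Point → Point → Point → Set ℓ₂
  InTriangle a b c z = Left a b z × Left b c z × Left c a z

  -- If ab misses cd although c and d lie on opposite sides of ab, then a and b
  -- lie on the same side of cd, and the one nearer to cd is in the triangle of
  -- the other three points.
  non-crossing : ∀ a b c d → Left a b c → Left b a d →
    (Left c d a → Left c d b → InTriangle b c d a) ×
    (Left d c a → Left d c b → InTriangle a d c b)
  non-crossing a b c d labc lbad =
    (λ lcda lcdb → Left-rotate a b c labc , lcda , Left-rotate a d b (Left-rotate b a d lbad)) ,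
    (λ ldca ldcb → Left-rotate b a d lbad , ldcb , Left-rotate b c a (Left-rotate a b c labc))

  -- Triangles and the convex hull

  module _ {n} (P : PointSet n) where
    open PointSet P
    open CommutativeMonoidSum +-commutativeMonoid
      using (∑-distrib-+; sum-cong-≋; sum-replicate-zero)
    open SemiringSum semiring using (*-distribˡ-sum)

    indicator : ∀ {m} → Fin m → Vector Carrier m
    indicator zero    zero    = 1#
    indicator zero    (suc _) = 0#
    indicator (suc i) zero    = 0#
    indicator (suc i) (suc j) = indicator i j

    indicator-nonneg : ∀ {m} (i j : Fin m) → 0# ≤ indicator i j
    indicator-nonneg zero    zero    = inj₁ 0<1
    indicator-nonneg zero    (suc _) = inj₂ refl
    indicator-nonneg (suc i) zero    = inj₂ refl
    indicator-nonneg (suc i) (suc j) = indicator-nonneg i j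

    sum-indicator : ∀ {m} (i : Fin m) (f : Vector Carrier m) →
      sum (λ j → indicator i j * f j) ≈ f i
    sum-indicator {ℕ.suc m} zero f = trans
      (+-cong (*-identityˡ _)
        (trans (sum-cong-≋ {m} (λ j → zeroˡ (f (suc j)))) (sum-replicate-zero m)))
      (+-identityʳ _)
    sum-indicator (suc i) f = trans
      (+-cong (zeroˡ _) (sum-indicator i (λ j → f (suc j)))) (+-identityˡ _)

    -- A combination of three points as a weight vector on the whole set. Built as a sum of
    -- indicators, it lets coinciding indices simply add their weights.
    weights : Carrier → Carrier → Carrier → Fin n → Fin n → Fin n → Vector Carrier n
    weights α β γ i j k m = α * indicator i m + (β * indicator j m + γ * indicator k m)

    sum-weights : ∀ α β γ i j k (f : Vector Carrier n) →
      sum (λ m → weights α β γ i j k m * f m) ≈ α * f i + (β * f j + γ * f k)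
    sum-weights α β γ i j k f = trans
      (sum-cong-≋ {n} (λ m →
        distribute α β γ (indicator i m) (indicator j m) (indicator k m) (f m)))
      (trans (∑-distrib-+ (λ m → α * (indicator i m * f m)) _)
        (+-cong (pull α i)
          (trans (∑-distrib-+ (λ m → β * (indicator j m * f m)) _) (+-cong (pull β j) (pull γ k)))))
      where
      distribute = solve 7 (λ α β γ u v w x →
        (α :* u :+ (β :* v :+ γ :* w)) :* x
        := α :* (u :* x) :+ (β :* (v :* x) :+ γ :* (w :* x))) refl
      pull : ∀ δ l → sum (λ m → δ * (indicator l m * f m)) ≈ δ * f l
      pull δ l = trans (sym (*-distribˡ-sum δ (λ m → indicator l m * f m)))
        (*-congˡ (sum-indicator l f))

    -- Barycentric coordinates: the weight of a corner is the area of the triangle that `z` spans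
    -- with the opposite side, and `τ` normalises by the total area.
    InTriangle⇒ConvexHull : ∀ i j k {z} →
      InTriangle (point i) (point j) (point k) z → z ∈ ConvexHull P
    InTriangle⇒ConvexHull i j k {z} (lij , ljk , lki)
      with pos-inverse (+-pos ljk (+-pos lki lij))
    ... | τ , 0<τ , Tτ≈1 = weights α β γ i j k , nonneg , total
      , coordinate proj₁ (bary-x (point i) (point j) (point k) z)
      , coordinate proj₂ (bary-y (point i) (point j) (point k) z)
      where
      A B C α β γ : Carrier
      A = det (point j) (point k) z
      B = det (point k) (point i) z
      C = det (point i) (point j) z
      α = A * τ
      β = B * τ
      γ = C * τ
      nonneg : ∀ m → 0# ≤ weights α β γ i j k m
      nonneg m = +-nonneg (*-nonneg (inj₁ (*-pos ljk 0<τ)) (indicator-nonneg i m))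
        (+-nonneg (*-nonneg (inj₁ (*-pos lki 0<τ)) (indicator-nonneg j m))
          (*-nonneg (inj₁ (*-pos lij 0<τ)) (indicator-nonneg k m)))
      total : sum (weights α β γ i j k) ≈ 1#
      total = trans (sum-cong-≋ {n} (λ m → sym (*-identityʳ (weights α β γ i j k m))))
        (trans (sum-weights α β γ i j k (λ _ → 1#))
          (trans (solve 4 (λ A B C τ →
              A :* τ :* :1 :+ (B :* τ :* :1 :+ C :* τ :* :1)
              := (A :+ (B :+ C)) :* τ) refl A B C τ)
            Tτ≈1))
      bary-x : ∀ a b c z → let A = det b c z ; B = det c a z ; C = det a b z in
        A * proj₁ a + (B * proj₁ b + C * proj₁ c) ≈ (A + (B + C)) * proj₁ z
      bary-x (x₁ , y₁) (x₂ , y₂) (x₃ , y₃) (x₄ , y₄) =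
        solve 8 (λ x₁ y₁ x₂ y₂ x₃ y₃ x₄ y₄ →
          let A = :det x₂ y₂ x₃ y₃ x₄ y₄
              B = :det x₃ y₃ x₁ y₁ x₄ y₄
              C = :det x₁ y₁ x₂ y₂ x₄ y₄ in
          A :* x₁ :+ (B :* x₂ :+ C :* x₃) := (A :+ (B :+ C)) :* x₄)
          refl x₁ y₁ x₂ y₂ x₃ y₃ x₄ y₄
      bary-y : ∀ a b c z → let A = det b c z ; B = det c a z ; C = det a b z in
        A * proj₂ a + (B * proj₂ b + C * proj₂ c) ≈ (A + (B + C)) * proj₂ z
      bary-y (x₁ , y₁) (x₂ , y₂) (x₃ , y₃) (x₄ , y₄) =
        solve 8 (λ x₁ y₁ x₂ y₂ x₃ y₃ x₄ y₄ →
          let A = :det x₂ y₂ x₃ y₃ x₄ y₄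
              B = :det x₃ y₃ x₁ y₁ x₄ y₄
              C = :det x₁ y₁ x₂ y₂ x₄ y₄ in
          A :* y₁ :+ (B :* y₂ :+ C :* y₃) := (A :+ (B :+ C)) :* y₄)
          refl x₁ y₁ x₂ y₂ x₃ y₃ x₄ y₄
      coordinate : ∀ {x} (coord : Point → Carrier) →
        A * coord (point i) + (B * coord (point j) + C * coord (point k)) ≈ (A + (B + C)) * x →
        x ≈ sum (λ m → weights α β γ i j k m * coord (point m))
      coordinate {x} coord bary = sym (trans (sum-weights α β γ i j k (λ m → coord (point m)))
        (trans (solve 7 (λ A B C τ x y z →
            A :* τ :* x :+ (B :* τ :* y :+ C :* τ :* z)
            := τ :* (A :* x :+ (B :* y :+ C :* z))) refl A B C τ _ _ _)
          (trans (*-congˡ bary)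
            (trans (solve 3 (λ τ T x → τ :* (T :* x) := (T :* τ) :* x) refl τ _ x)
              (trans (*-congʳ Tτ≈1) (*-identityˡ x))))))

    -- The smallest radius for the three bounding half-planes gives a ball inside the triangle,
    -- hence inside the hull, whereas every ball about a boundary point contains a point outside the
    -- hull.
    ¬InTriangle : ConvexPosition P → ∀ i j k l →
      ¬ InTriangle (point i) (point j) (point k) (point l)
    ¬InTriangle convex i j k l (lij , ljk , lki) =
      let (ε₁ , 0<ε₁ , near₁) = Left-near (point i) (point j) (point l) lij
          (ε₂ , 0<ε₂ , near₂) = Left-near (point j) (point k) (point l) ljk
          (ε₃ , 0<ε₃ , near₃) = Left-near (point k) (point i) (point l) lki
          (ε₁₂ , 0<ε₁₂ , ε₁₂≤) = common-radius 0<ε₁ 0<ε₂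
          (ε , 0<ε , ε≤) = common-radius 0<ε₁₂ 0<ε₃
          (_ , y , y∈ball , y∉hull) = convex l ε 0<ε
          (y∈ball₁₂ , y∈ball₃) = ε≤ y∈ball
          (y∈ball₁ , y∈ball₂) = ε₁₂≤ y∈ball₁₂
      in y∉hull (InTriangle⇒ConvexHull i j k
           (near₁ y y∈ball₁ , near₂ y y∈ball₂ , near₃ y y∈ball₃))

  -- Lexicographic and angular order

  infixl 6 _+ₚ_
  infixl 7 _*ₚ_

  _+ₚ_ : Point → Point → Point
  (x₁ , y₁) +ₚ (x₂ , y₂) = x₁ + x₂ , y₁ + y₂

  _*ₚ_ : Carrier → Point → Point
  t *ₚ (x , y) = t * x , t * y

  vec : Point → Point → Point
  vec (x₁ , y₁) (x₂ , y₂) = x₂ - x₁ , y₂ - y₁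

  -- An open half-plane together with one open ray of its boundary line. The ray accommodates points
  -- with equal first coordinates: of a nonzero vector and its negative, exactly one is positive.
  LexPos : Point → Set _
  LexPos (x , y) = 0# < x ⊎ (x ≈ 0# × 0# < y)

  LexPos-resp : ∀ {u v} → u ≈ₚ v → LexPos u → LexPos v
  LexPos-resp (x≈ , y≈) (inj₁ 0<x)         = inj₁ (pos-resp x≈ 0<x)
  LexPos-resp (x≈ , y≈) (inj₂ (x≈0 , 0<y)) = inj₂ (trans (sym x≈) x≈0 , pos-resp y≈ 0<y)

  ¬LexPos-0 : ∀ {v} → v ≈ₚ (0# , 0#) → ¬ LexPos v
  ¬LexPos-0 (x≈0 , _) (inj₁ 0<x)       = pos⇒≉0 0<x x≈0
  ¬LexPos-0 (_ , y≈0) (inj₂ (_ , 0<y)) = pos⇒≉0 0<y y≈0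

  LexPos-+ : ∀ {u v} → LexPos u → LexPos v → LexPos (u +ₚ v)
  LexPos-+ (inj₁ 0<x)        (inj₁ 0<x′)         = inj₁ (+-pos 0<x 0<x′)
  LexPos-+ (inj₁ 0<x)        (inj₂ (x′≈0 , _))   = inj₁ (pos+nonneg 0<x (inj₂ (sym x′≈0)))
  LexPos-+ (inj₂ (x≈0 , _))  (inj₁ 0<x′)         =
    inj₁ (pos-resp (+-comm _ _) (pos+nonneg 0<x′ (inj₂ (sym x≈0))))
  LexPos-+ (inj₂ (x≈0 , 0<y)) (inj₂ (x′≈0 , 0<y′)) =
    inj₂ (trans (+-cong x≈0 x′≈0) (+-identityˡ 0#) , +-pos 0<y 0<y′)

  LexPos-* : ∀ {t v} → 0# < t → LexPos v → LexPos (t *ₚ v)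
  LexPos-* 0<t (inj₁ 0<x)         = inj₁ (*-pos 0<t 0<x)
  LexPos-* 0<t (inj₂ (x≈0 , 0<y)) = inj₂ (trans (*-congˡ x≈0) (zeroʳ _) , *-pos 0<t 0<y)

  LexPos-total : ∀ a b → ¬ a ≈ₚ b → LexPos (vec a b) ⊎ LexPos (vec b a)
  LexPos-total (x₁ , y₁) (x₂ , y₂) a≉b with compare x₁ x₂
  ... | tri< x₁<x₂ _ _ = inj₁ (inj₁ (diff-pos x₁<x₂))
  ... | tri> _ _ x₂<x₁ = inj₂ (inj₁ (diff-pos x₂<x₁))
  ... | tri≈ _ x₁≈x₂ _ with compare y₁ y₂
  ...   | tri< y₁<y₂ _ _ =
    inj₁ (inj₂ (trans (+-congʳ (sym x₁≈x₂)) (-‿inverseʳ x₁) , diff-pos y₁<y₂))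
  ...   | tri≈ _ y₁≈y₂ _ = ⊥-elim (a≉b (x₁≈x₂ , y₁≈y₂))
  ...   | tri> _ _ y₂<y₁ =
    inj₂ (inj₂ (trans (+-congʳ x₁≈x₂) (-‿inverseʳ x₂) , diff-pos y₂<y₁))

  LexPos-trans : ∀ a b c → LexPos (vec a b) → LexPos (vec b c) → LexPos (vec a c)
  LexPos-trans (x₁ , y₁) (x₂ , y₂) (x₃ , y₃) ab bc =
    LexPos-resp (eq x₁ x₂ x₃ , eq y₁ y₂ y₃) (LexPos-+ ab bc)
    where
    eq = solve 3 (λ x y z → (y :- x) :+ (z :- y) := z :- x) refl

  -- By the Plücker relation, `det p a c` times the vector from `p` to `b` is a positive combination
  -- of the vectors to `a` and `c`, hence lexicographically positive. As the vector to `b` is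
  -- positive itself, its factor can be neither zero nor negative.
  Left-trans : ∀ p a b c → LexPos (vec p a) → LexPos (vec p b) → LexPos (vec p c) →
    Left p a b → Left p b c → Left p a c
  Left-trans p a b c pa pb pc lab lbc = decide (sign (det p a c))
    where
    combination : LexPos (det p b c *ₚ vec p a +ₚ det p a b *ₚ vec p c)
    combination = LexPos-+ (LexPos-* lbc pa) (LexPos-* lab pc)
    plücker : ∀ p a b c →
      det p b c *ₚ vec p a +ₚ det p a b *ₚ vec p c ≈ₚ det p a c *ₚ vec p b
    plücker (x₁ , y₁) (x₂ , y₂) (x₃ , y₃) (x₄ , y₄) =
      solve 8 (λ x₁ y₁ x₂ y₂ x₃ y₃ x₄ y₄ →
        :det x₁ y₁ x₃ y₃ x₄ y₄ :* (x₂ :- x₁) :+ :det x₁ y₁ x₂ y₂ x₃ y₃ :* (x₄ :- x₁)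
        := :det x₁ y₁ x₂ y₂ x₄ y₄ :* (x₃ :- x₁)) refl x₁ y₁ x₂ y₂ x₃ y₃ x₄ y₄ ,
      solve 8 (λ x₁ y₁ x₂ y₂ x₃ y₃ x₄ y₄ →
        :det x₁ y₁ x₃ y₃ x₄ y₄ :* (y₂ :- y₁) :+ :det x₁ y₁ x₂ y₂ x₃ y₃ :* (y₄ :- y₁)
        := :det x₁ y₁ x₂ y₂ x₄ y₄ :* (y₃ :- y₁)) refl x₁ y₁ x₂ y₂ x₃ y₃ x₄ y₄
    combination′ : LexPos (det p a c *ₚ vec p b)
    combination′ = LexPos-resp (plücker p a b c) combination
    decide : 0# < det p a c ⊎ det p a c ≈ 0# ⊎ 0# < - det p a c → Left p a c
    decide (inj₁ l)         = l
    decide (inj₂ (inj₁ e))  = ⊥-elim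
      (¬LexPos-0 (trans (*-congʳ e) (zeroˡ _) , trans (*-congʳ e) (zeroˡ _)) combination′)
    decide (inj₂ (inj₂ r))  = ⊥-elim
      (¬LexPos-0 (cancel _ _ , cancel _ _) (LexPos-+ combination′ (LexPos-* r pb)))
      where
      cancel = solve 2 (λ t x → t :* x :+ (:- t) :* x := :0) refl

-- Imported only here: these names clash with those of the ordered field.
open import Data.Nat.Base
  using (ℕ; zero; suc; _+_; _≤_; _<_; _∸_; z≤n; s≤s; ⌊_/2⌋; ⌈_/2⌉)
open import Relation.Binary.PropositionalEquality
  using (refl; sym; trans; cong; cong₂; subst; ≢-sym; module ≡-Reasoning)

import Data.Fin.Base as Fin
import Data.Fin.Properties as Fin
open import Data.List.Base
  using (List; []; _∷_; _++_; [_]; map; length; filter; allFin; upTo)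
import Data.List.Extrema.Nat as Extrema
import Data.List.Membership.DecPropositional as DecMembership
open import Data.List.Membership.Propositional using () renaming (_∈_ to _∈ₗ_; _∉_ to _∉ₗ_)
open import Data.List.Membership.Propositional.Properties
  using (∈-∃++; ∈-++⁻; ∈-++⁺ˡ; ∈-++⁺ʳ; ∈-filter⁺; ∈-filter⁻; ∈-map⁻; ∈-upTo⁺; ∈-allFin)
open import Data.List.Properties using (length-++; length-map; length-upTo; length-tabulate)
open import Data.List.Relation.Binary.Subset.Propositional using (_⊆_)
open import Data.List.Relation.Unary.All as All using (All; []; _∷_)
import Data.List.Relation.Unary.All.Properties as All
open import Data.List.Relation.Unary.AllPairs as AllPairs using (AllPairs; []; _∷_)
import Data.List.Relation.Unary.AllPairs.Properties as AllPairs
open import Data.List.Relation.Unary.Any using (here; there)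
open import Data.List.Relation.Unary.Unique.Propositional using (Unique)
import Data.List.Relation.Unary.Unique.Propositional.Properties as Unique
open import Data.Nat.Combinatorics using (_C_; nC1≡n; nCk+nC[k+1]≡[n+1]C[k+1])
import Data.Nat.Properties as ℕ
open import Function.Base using (_∘_)
open import Function.Bundles using (mk⇔)
open import Level using (_⊔_)
open import Relation.Binary.Core using (Rel)

-- Counting with lists without repetition

module _ {a} {A : Set a} where

  ∉⇒unique : ∀ {x : A} {xs} → x ∉ₗ xs → Unique xs → Unique (x ∷ xs)
  ∉⇒unique x∉xs xs! = All.tabulate (λ y∈xs x≡y → x∉xs (subst (_∈ₗ _) (sym x≡y) y∈xs)) ∷ xs!

  unique⊆⇒length≤ : ∀ {xs ys : List A} → Unique xs → xs ⊆ ys → length xs ≤ length ys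
  unique⊆⇒length≤ {[]}     _  _ = z≤n
  unique⊆⇒length≤ {x ∷ xs} xs! xs⊆ with ∈-∃++ (xs⊆ (here refl))
  ... | us , vs , refl =
    ℕ.≤-trans (s≤s (unique⊆⇒length≤ (AllPairs.tail xs!) tail⊆)) (ℕ.≤-reflexive eq)
    where
    tail⊆ : xs ⊆ us ++ vs
    tail⊆ y∈xs with ∈-++⁻ us (xs⊆ (there y∈xs))
    ... | inj₁ y∈us         = ∈-++⁺ˡ y∈us
    ... | inj₂ (here refl)  = ⊥-elim (Unique.Unique[x∷xs]⇒x∉xs xs! y∈xs)
    ... | inj₂ (there y∈vs) = ∈-++⁺ʳ us y∈vs
    eq : suc (length (us ++ vs)) ≡ length (us ++ [ x ] ++ vs)
    eq = trans (cong suc (length-++ us))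
      (trans (sym (ℕ.+-suc (length us) (length vs))) (sym (length-++ us)))

  unique⊆⊇⇒length≡ : ∀ {xs ys : List A} → Unique xs → Unique ys → xs ⊆ ys → ys ⊆ xs →
    length xs ≡ length ys
  unique⊆⊇⇒length≡ xs! ys! xs⊆ys ys⊆xs =
    ℕ.≤-antisym (unique⊆⇒length≤ xs! xs⊆ys) (unique⊆⇒length≤ ys! ys⊆xs)

  unique⊆∧length≥⇒⊇ : DecidableEquality A → ∀ {xs ys : List A} →
    Unique xs → xs ⊆ ys → length ys ≤ length xs → ys ⊆ xs
  unique⊆∧length≥⇒⊇ _≟_ {xs} xs! xs⊆ys len {y} y∈ys with DecMembership._∈?_ _≟_ y xs
  ... | yes y∈xs = y∈xs
  ... | no  y∉xs = ⊥-elim (ℕ.<-irrefl refl (ℕ.≤-trans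
    (unique⊆⇒length≤ (∉⇒unique y∉xs xs!) λ { (here refl) → y∈ys ; (there z∈xs) → xs⊆ys z∈xs }) len))

  unique-map : ∀ {b} {B : Set b} (f : A → B) {xs} →
    (∀ {x y} → x ∈ₗ xs → y ∈ₗ xs → x ≢ y → f x ≢ f y) → Unique xs → Unique (map f xs)
  unique-map f {[]}     _   _          = []
  unique-map f {x ∷ xs} inj (x∉ ∷ xs!) =
    All.map⁺ (All.tabulate λ y∈xs → inj (here refl) (there y∈xs) (All.lookup x∉ y∈xs))
    ∷ unique-map f (λ x∈ y∈ → inj (there x∈) (there y∈)) xs!

module _ {a} {A : Set a} where

  -- Ranks of distinct elements are distinct and less than length xs, so by the
  -- pigeonhole principle every number less than length xs is a rank.
  element-of-rank : ∀ {ℓ} {_≺_ : Rel A ℓ} (_≺?_ : Decidable _≺_) → ∀ {xs} → Unique xs →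
    (∀ {x} → ¬ x ≺ x) →
    (∀ {x y} → x ∈ₗ xs → y ∈ₗ xs → x ≢ y → x ≺ y ⊎ y ≺ x) →
    (∀ {x y z} → x ∈ₗ xs → y ∈ₗ xs → z ∈ₗ xs → x ≺ y → y ≺ z → x ≺ z) →
    ∀ {k} → k < length xs → ∃[ x ] x ∈ₗ xs × length (filter (_≺? x) xs) ≡ k
  element-of-rank {_≺_ = _≺_} _≺?_ {xs} xs! irrefl total transitive {k} k<len
    with ∈-map⁻ rank (unique⊆∧length≥⇒⊇ ℕ._≟_ ranks! ranks⊆ len (∈-upTo⁺ k<len))
    where
    below : A → List A
    below x = filter (_≺? x) xs
    rank : A → ℕ
    rank x = length (below x)
    -- With `x` itself put in front, the length bound for this list yields the strict inequalities
    -- of `rank<` and `rank-mono` directly.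
    below! : ∀ x → Unique (x ∷ below x)
    below! x = ∉⇒unique (λ x∈ → irrefl (proj₂ (∈-filter⁻ (_≺? x) {xs = xs} x∈)))
      (Unique.filter⁺ (_≺? x) xs!)
    rank< : ∀ {x} → x ∈ₗ xs → rank x < length xs
    rank< {x} x∈xs = unique⊆⇒length≤ (below! x)
      λ { (here refl) → x∈xs ; (there y∈) → proj₁ (∈-filter⁻ (_≺? x) y∈) }
    rank-mono : ∀ {x y} → x ∈ₗ xs → y ∈ₗ xs → x ≺ y → rank x < rank y
    rank-mono {x} {y} x∈ y∈ x≺y = unique⊆⇒length≤ (below! x) λ
      { (here refl) → ∈-filter⁺ (_≺? y) x∈ x≺y
      ; (there z∈)  → let (z∈xs , z≺x) = ∈-filter⁻ (_≺? x) z∈ in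
          ∈-filter⁺ (_≺? y) z∈xs (transitive z∈xs x∈ y∈ z≺x x≺y) }
    rank-injective : ∀ {x y} → x ∈ₗ xs → y ∈ₗ xs → x ≢ y → rank x ≢ rank y
    rank-injective x∈ y∈ x≢y with total x∈ y∈ x≢y
    ... | inj₁ x≺y = ℕ.<⇒≢ (rank-mono x∈ y∈ x≺y)
    ... | inj₂ y≺x = ≢-sym (ℕ.<⇒≢ (rank-mono y∈ x∈ y≺x))
    ranks! : Unique (map rank xs)
    ranks! = unique-map rank rank-injective xs!
    ranks⊆ : map rank xs ⊆ upTo (length xs)
    ranks⊆ r∈ with ∈-map⁻ rank r∈
    ... | x , x∈xs , refl = ∈-upTo⁺ (rank< x∈xs)
    len : length (upTo (length xs)) ≤ length (map rank xs)
    len = ℕ.≤-reflexive (trans (length-upTo _) (sym (length-map rank xs)))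
  ... | x , x∈xs , k≡ = x , x∈xs , sym k≡

-- Binomial coefficients: the balanced split is the smallest

suc-C-2 : ∀ m → suc m C 2 ≡ m + m C 2
suc-C-2 m = trans (sym (nCk+nC[k+1]≡[n+1]C[k+1] m 1)) (cong (_+ m C 2) (nC1≡n m))

halves-double : ∀ m → ⌊ m + m /2⌋ ≡ m × ⌈ m + m /2⌉ ≡ m
halves-double zero    = refl , refl
halves-double (suc m) rewrite ℕ.+-suc m m = let (p , q) = halves-double m in cong suc p , cong suc q

halves-suc-double : ∀ m → ⌊ suc (m + m) /2⌋ ≡ m × ⌈ suc (m + m) /2⌉ ≡ suc m
halves-suc-double m = let (p , q) = halves-double m in q , cong suc p

-- Induction on the difference `d` in steps of two. Moving one element from the larger part to the
-- smaller keeps the total and adds `m` while removing `suc d + m`; the differences 0 and 1 are the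
-- balanced splits, where equality holds.
κ≤C₂+C₂-spread : ∀ m d → κ (2 + (m + (d + m))) ≤ m C 2 + (d + m) C 2
κ≤C₂+C₂-spread m 0 = let (p , q) = halves-double m in
  ℕ.≤-reflexive (cong₂ (λ a b → a C 2 + b C 2) p q)
κ≤C₂+C₂-spread m 1 rewrite ℕ.+-suc m m = let (p , q) = halves-suc-double m in
  ℕ.≤-reflexive (cong₂ (λ a b → a C 2 + b C 2) p q)
κ≤C₂+C₂-spread m (suc (suc d)) = begin
  κ (2 + (m + suc (suc d + m)))
    ≡⟨ cong (κ ∘ (2 +_)) (ℕ.+-suc m (suc d + m)) ⟩
  κ (2 + (suc m + suc (d + m)))
    ≡⟨ cong (λ x → κ (2 + (suc m + x))) (ℕ.+-suc d m) ⟨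
  κ (2 + (suc m + (d + suc m)))
    ≤⟨ κ≤C₂+C₂-spread (suc m) d ⟩
  suc m C 2 + (d + suc m) C 2
    ≡⟨ cong₂ (λ x y → x + y C 2) (suc-C-2 m) (ℕ.+-suc d m) ⟩
  (m + m C 2) + (suc d + m) C 2
    ≤⟨ ℕ.+-monoˡ-≤ _ (ℕ.+-monoˡ-≤ (m C 2) (ℕ.m≤n+m m (suc d))) ⟩
  ((suc d + m) + m C 2) + (suc d + m) C 2
    ≡⟨ cong (_+ (suc d + m) C 2) (ℕ.+-comm (suc d + m) (m C 2)) ⟩
  (m C 2 + (suc d + m)) + (suc d + m) C 2
    ≡⟨ ℕ.+-assoc (m C 2) _ _ ⟩
  m C 2 + ((suc d + m) + (suc d + m) C 2)
    ≡⟨ cong (m C 2 +_) (suc-C-2 (suc d + m)) ⟨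
  m C 2 + suc (suc d + m) C 2 ∎
  where open ℕ.≤-Reasoning

κ≤C₂+C₂ : ∀ m n → κ (2 + (m + n)) ≤ m C 2 + n C 2
κ≤C₂+C₂ m n with ℕ.≤-total m n
... | inj₁ m≤n = subst (λ n → κ (2 + (m + n)) ≤ m C 2 + n C 2) (ℕ.m∸n+n≡m m≤n)
  (κ≤C₂+C₂-spread m (n ∸ m))
... | inj₂ n≤m = subst (λ m → κ (2 + (m + n)) ≤ m C 2 + n C 2) (ℕ.m∸n+n≡m n≤m)
  (subst (λ s → κ (2 + s) ≤ (m ∸ n + n) C 2 + n C 2) (ℕ.+-comm n (m ∸ n + n))
    (ℕ.≤-trans (κ≤C₂+C₂-spread n (m ∸ n)) (ℕ.≤-reflexive (ℕ.+-comm (n C 2) _))))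

-- Enumerating the unordered pairs from a sorted list

module SortedPairs {c ℓ₁ ℓ₂} (F : OrderedField c ℓ₁ ℓ₂) {n : ℕ} where
  open Plane F using (Pair; module Pair; pair)

  pairsFrom : ∀ {x : Fin n} {ys} → All (x Fin.<_) ys → List (Pair n)
  pairsFrom {x} = All.reduce (λ {y} x<y → pair x y x<y)

  -- The recursion runs over the proof of sortedness, whose entries are the inequalities that `Pair`
  -- demands. Sorting also ensures that each unordered pair occurs in just one order.
  pairs : ∀ {xs : List (Fin n)} → AllPairs Fin._<_ xs → List (Pair n)
  pairs []         = []
  pairs (x< ∷ xs<) = pairsFrom x< ++ pairs xs<

  length-pairsFrom : ∀ {x : Fin n} {ys} (x< : All (x Fin.<_) ys) → length (pairsFrom x<) ≡ length ys
  length-pairsFrom []       = refl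
  length-pairsFrom (_ ∷ x<) = cong suc (length-pairsFrom x<)

  length-pairs : ∀ {xs : List (Fin n)} (xs< : AllPairs Fin._<_ xs) →
    length (pairs xs<) ≡ length xs C 2
  length-pairs []                  = refl
  length-pairs {_ ∷ xs} (x< ∷ xs<) = trans (length-++ (pairsFrom x<))
    (trans (cong₂ _+_ (length-pairsFrom x<) (length-pairs xs<)) (sym (suc-C-2 (length xs))))

  ∈-pairsFrom⁻ : ∀ {x : Fin n} {ys} (x< : All (x Fin.<_) ys) {e} → e ∈ₗ pairsFrom x< →
    Pair.lo e ≡ x × Pair.hi e ∈ₗ ys
  ∈-pairsFrom⁻ (_ ∷ x<) (here refl) = refl , here refl
  ∈-pairsFrom⁻ (_ ∷ x<) (there e∈)  = let (lo≡ , hi∈) = ∈-pairsFrom⁻ x< e∈ in lo≡ , there hi∈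

  ∈-pairsFrom⁺ : ∀ {x y : Fin n} {ys} (x< : All (x Fin.<_) ys) .(x<y : x Fin.< y) → y ∈ₗ ys →
    pair x y x<y ∈ₗ pairsFrom x<
  ∈-pairsFrom⁺ (_ ∷ x<) x<y (here refl) = here refl
  ∈-pairsFrom⁺ (_ ∷ x<) x<y (there y∈)  = there (∈-pairsFrom⁺ x< x<y y∈)

  ∈-pairs⁻ : ∀ {xs : List (Fin n)} (xs< : AllPairs Fin._<_ xs) {e} → e ∈ₗ pairs xs< →
    Pair.lo e ∈ₗ xs × Pair.hi e ∈ₗ xs
  ∈-pairs⁻ (x< ∷ xs<) e∈ with ∈-++⁻ (pairsFrom x<) e∈
  ... | inj₁ e∈ˡ = let (lo≡ , hi∈) = ∈-pairsFrom⁻ x< e∈ˡ in here lo≡ , there hi∈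
  ... | inj₂ e∈ʳ = let (lo∈ , hi∈) = ∈-pairs⁻ xs< e∈ʳ in there lo∈ , there hi∈

  ∈-pairs⁺ : ∀ {xs : List (Fin n)} (xs< : AllPairs Fin._<_ xs) e →
    Pair.lo e ∈ₗ xs → Pair.hi e ∈ₗ xs → e ∈ₗ pairs xs<
  ∈-pairs⁺ (x< ∷ xs<) (pair x y x<y) (here refl) (here refl) =
    -- The inequality stored in a `Pair` is irrelevant, so a usable proof is recovered from its
    -- decision procedure.
    ⊥-elim (Fin.<-irrefl refl (recompute (x Fin.<? y) x<y))
  ∈-pairs⁺ (x< ∷ xs<) (pair x y x<y) (here refl) (there y∈) = ∈-++⁺ˡ (∈-pairsFrom⁺ x< x<y y∈)
  ∈-pairs⁺ (x< ∷ xs<) (pair x y x<y) (there x∈) (here refl) =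
    ⊥-elim (Fin.<-asym (All.lookup x< x∈) (recompute (x Fin.<? y) x<y))
  ∈-pairs⁺ (x< ∷ xs<) e (there x∈) (there y∈) = ∈-++⁺ʳ (pairsFrom x<) (∈-pairs⁺ xs< e x∈ y∈)

  sorted⇒unique : ∀ {xs : List (Fin n)} → AllPairs Fin._<_ xs → Unique xs
  sorted⇒unique = AllPairs.map Fin.<⇒≢

  unique-pairsFrom : ∀ {x : Fin n} {ys} (x< : All (x Fin.<_) ys) → Unique ys → Unique (pairsFrom x<)
  unique-pairsFrom []       _           = []
  unique-pairsFrom (_ ∷ x<) ys!@(_ ∷ p) = ∉⇒unique
    (λ e∈ → Unique.Unique[x∷xs]⇒x∉xs ys! (proj₂ (∈-pairsFrom⁻ x< e∈)))
    (unique-pairsFrom x< p)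

  unique-pairs : ∀ {xs : List (Fin n)} (xs< : AllPairs Fin._<_ xs) → Unique (pairs xs<)
  unique-pairs []               = []
  unique-pairs s@(x< ∷ xs<) =
    Unique.++⁺ (unique-pairsFrom x< (sorted⇒unique xs<)) (unique-pairs xs<)
    λ (e∈ˡ , e∈ʳ) → Unique.Unique[x∷xs]⇒x∉xs (sorted⇒unique s)
      (subst (_∈ₗ _) (proj₁ (∈-pairsFrom⁻ x< e∈ˡ)) (proj₁ (∈-pairs⁻ xs< e∈ʳ)))

minimum-exists : ∀ {m ℓ} {_≺_ : Rel (Fin (suc m)) ℓ} →
  (∀ {i j} → i ≢ j → i ≺ j ⊎ j ≺ i) → (∀ {i j k} → i ≺ j → j ≺ k → i ≺ k) →
  ∃[ p ] (∀ i → i ≢ p → p ≺ i)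
minimum-exists {zero} total transitive = zero , λ { zero 0≢0 → ⊥-elim (0≢0 refl) }
minimum-exists {suc m} total transitive
  with minimum-exists {m} (λ i≢j → total (i≢j ∘ Fin.suc-injective)) transitive
... | p , min with total {zero} {suc p} (λ ())
...   | inj₂ p≺0 = suc p , λ { zero _ → p≺0 ; (suc i) i≢p → min i (i≢p ∘ cong suc) }
...   | inj₁ 0≺p = zero , λ { zero 0≢0 → ⊥-elim (0≢0 refl) ; (suc i) _ → below i }
  where
  below : ∀ i → _
  below i with i Fin.≟ p
  ... | yes refl = 0≺p
  ... | no  i≢p  = transitive 0≺p (min i i≢p)

-- Sides of an edge and disjointness of segments

module EdgeDisjointness {c ℓ₁ ℓ₂} (F : OrderedField c ℓ₁ ℓ₂) {n}
  (P : Plane.PointSet F n) (general : Plane.GeneralPosition F P) where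
  open PlaneGeometry F
  open OrderedFieldProperties F using (_<?_)
  open Plane F
  open PointSet P
  open SortedPairs F

  -- LeftOf and Disjoint are wrapped in records so that unification and
  -- with-abstraction do not unfold them to field arithmetic.
  record LeftOf (i j k : Fin n) : Set ℓ₂ where
    constructor leftOf
    field isLeft : Left (point i) (point j) (point k)
  open LeftOf

  LeftOf? : ∀ i j k → Dec (LeftOf i j k)
  LeftOf? i j k = map′ leftOf isLeft (_ <? det (point i) (point j) (point k))

  LeftOf-rotate : ∀ {i j k} → LeftOf i j k → LeftOf j k i
  LeftOf-rotate {i} {j} {k} (leftOf l) = leftOf (Left-rotate (point i) (point j) (point k) l)

  LeftOf-asym : ∀ {i j k} → LeftOf i j k → ¬ LeftOf j i k
  LeftOf-asym {i} {j} {k} (leftOf l) (leftOf r) = Left-asym (point i) (point j) (point k) l r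

  LeftOf-irrefl : ∀ {i j} → ¬ LeftOf i i j
  LeftOf-irrefl {i} {j} (leftOf l) = Left-irrefl (point i) (point j) l

  LeftOf⇒≢₁ : ∀ {i j k} → LeftOf i j k → k ≢ i
  LeftOf⇒≢₁ l refl = LeftOf-irrefl (LeftOf-rotate (LeftOf-rotate l))

  LeftOf⇒≢₂ : ∀ {i j k} → LeftOf i j k → k ≢ j
  LeftOf⇒≢₂ l refl = LeftOf-irrefl (LeftOf-rotate l)

  -- Otherwise with-abstraction would normalise the ring solver's proof terms.
  abstract
    sideOf : ∀ {i j k} → i ≢ j → i ≢ k → j ≢ k → LeftOf i j k ⊎ LeftOf j i k
    sideOf {i} {j} {k} i≢j i≢k j≢k = Sum.map leftOf leftOf (side (point i) (point j) (point k)
      λ det≈0 → general i j k i≢j i≢k j≢k (det≈0⇒Collinear (i≢j ∘ distinct) det≈0))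

  allFin< : AllPairs Fin._<_ (allFin n)
  allFin< = AllPairs.tabulate⁺-< λ i<j → i<j

  left : Fin n → Fin n → List (Fin n)
  left i j = filter (LeftOf? i j) (allFin n)

  left< : ∀ i j → AllPairs Fin._<_ (left i j)
  left< i j = AllPairs.filter⁺ (LeftOf? i j) allFin<

  ∈-left⁻ : ∀ {i j k} → k ∈ₗ left i j → LeftOf i j k
  ∈-left⁻ {i} {j} k∈ = proj₂ (∈-filter⁻ (LeftOf? i j) {xs = allFin n} k∈)

  ∈-left⁺ : ∀ {i j k} → LeftOf i j k → k ∈ₗ left i j
  ∈-left⁺ {i} {j} = ∈-filter⁺ (LeftOf? i j) (∈-allFin _)

  Other? : ∀ (i j k : Fin n) → Dec (k ≢ i × k ≢ j)
  Other? i j k = ¬? (k Fin.≟ i) ×-dec ¬? (k Fin.≟ j)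

  others : Fin n → Fin n → List (Fin n)
  others i j = filter (Other? i j) (allFin n)

  others< : ∀ i j → AllPairs Fin._<_ (others i j)
  others< i j = AllPairs.filter⁺ (Other? i j) allFin<

  ∈-others⁻ : ∀ {i j k} → k ∈ₗ others i j → k ≢ i × k ≢ j
  ∈-others⁻ {i} {j} k∈ = proj₂ (∈-filter⁻ (Other? i j) {xs = allFin n} k∈)

  ∈-others⁺ : ∀ {i j k} → k ≢ i → k ≢ j → k ∈ₗ others i j
  ∈-others⁺ {i} {j} k≢i k≢j = ∈-filter⁺ (Other? i j) (∈-allFin _) (k≢i , k≢j)

  length-others : ∀ {i j} → i ≢ j → 2 + length (others i j) ≡ n
  length-others {i} {j} i≢j = trans
    (unique⊆⊇⇒length≡
      (∉⇒unique (λ { (here i≡j) → i≢j i≡j ; (there i∈) → proj₁ (∈-others⁻ i∈) refl })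
        (∉⇒unique (λ j∈ → proj₂ (∈-others⁻ j∈) refl) (sorted⇒unique (others< i j))))
      (sorted⇒unique allFin<) (λ {k} _ → ∈-allFin k) (λ {k} _ → cover k))
    (length-tabulate {n = n} (λ k → k))
    where
    cover : ∀ k → k ∈ₗ i ∷ j ∷ others i j
    cover k with k Fin.≟ i | k Fin.≟ j
    ... | yes k≡i | _       = here k≡i
    ... | no  _   | yes k≡j = there (here k≡j)
    ... | no  k≢i | no  k≢j = there (there (∈-others⁺ k≢i k≢j))

  unique-sides : ∀ i j → Unique (left i j ++ left j i)
  unique-sides i j = Unique.++⁺ (sorted⇒unique (left< i j)) (sorted⇒unique (left< j i))
    λ (k∈ˡ , k∈ʳ) → LeftOf-asym (∈-left⁻ k∈ˡ) (∈-left⁻ k∈ʳ)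

  length-sides : ∀ {i j} → i ≢ j → 2 + (length (left i j) + length (left j i)) ≡ n
  length-sides {i} {j} i≢j = trans (cong (2 +_) (trans (sym (length-++ (left i j)))
    (unique⊆⊇⇒length≡ (unique-sides i j) (sorted⇒unique (others< i j)) to from)))
    (length-others i≢j)
    where
    to : left i j ++ left j i ⊆ others i j
    to k∈ with ∈-++⁻ (left i j) k∈
    ... | inj₁ k∈ˡ = let l = ∈-left⁻ k∈ˡ in ∈-others⁺ (LeftOf⇒≢₁ l) (LeftOf⇒≢₂ l)
    ... | inj₂ k∈ʳ = let r = ∈-left⁻ k∈ʳ in ∈-others⁺ (LeftOf⇒≢₂ r) (LeftOf⇒≢₁ r)
    from : others i j ⊆ left i j ++ left j i
    from k∈ with ∈-others⁻ k∈
    ... | k≢i , k≢j with sideOf i≢j (≢-sym k≢i) (≢-sym k≢j)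
    ...   | inj₁ l = ∈-++⁺ˡ (∈-left⁺ l)
    ...   | inj₂ r = ∈-++⁺ʳ (left i j) (∈-left⁺ r)

  lo≢hi : ∀ (e : Pair n) → Pair.lo e ≢ Pair.hi e
  lo≢hi (pair i j i<j) = Fin.<⇒≢ (recompute (i Fin.<? j) i<j)

  record Disjoint (i j k l : Fin n) : Set (c ⊔ ℓ₁ ⊔ ℓ₂) where
    constructor disjoint
    field segments⊥ : Segment (point i) (point j) ⊥ Segment (point k) (point l)
  open Disjoint

  same-side : ∀ {i j k l} → LeftOf i j k → LeftOf i j l → Disjoint i j k l
  same-side {i} {j} {k} {l} (leftOf lk) (leftOf ll) =
    disjoint (same-side⇒disjoint (point i) (point j) (point k) (point l) lk ll)

  Disjoint-swap : ∀ {i j k l} → Disjoint i j k l → Disjoint j i k l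
  Disjoint-swap {i} {j} (disjoint ij⊥kl) =
    disjoint λ (z∈ji , z∈kl) → ij⊥kl (Segment-sym (point j) (point i) z∈ji , z∈kl)

  Disjoint-sym : ∀ {i j k l} → Disjoint i j k l → Disjoint k l i j
  Disjoint-sym (disjoint ij⊥kl) = disjoint λ (z∈kl , z∈ij) → ij⊥kl (z∈ij , z∈kl)

  Disjoint⇒others : ∀ {i j k l} → Disjoint i j k l → k ∈ₗ others i j × l ∈ₗ others i j
  Disjoint⇒others {i} {j} {k} {l} (disjoint ij⊥kl) =
    ∈-others⁺ (λ { refl → ij⊥kl (start∈segment _ _ , start∈kl) })
              (λ { refl → ij⊥kl (end∈segment (point i) _ , start∈kl) }) ,
    ∈-others⁺ (λ { refl → ij⊥kl (start∈segment _ _ , end∈kl) })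
              (λ { refl → ij⊥kl (end∈segment (point i) _ , end∈kl) })
    where
    start∈kl = start∈segment (point k) (point l)
    end∈kl   = end∈segment (point k) (point l)

  -- The two `near` cases are named after the one of `i` and `j` that is nearer to the line `kl`.
  -- They are kept apart from `crossing` because they mean disjointness in general and a
  -- contradiction in convex position.
  data OppositeSides (i j k l : Fin n) : Set (c ⊔ ℓ₁ ⊔ ℓ₂) where
    crossing    : ¬ Disjoint i j k l → OppositeSides i j k l
    near-first  : LeftOf k l i → LeftOf k l j → OppositeSides i j k l
    near-second : LeftOf l k i → LeftOf l k j → OppositeSides i j k l

  oppositeSides : ∀ {i j k l} → k ≢ l → LeftOf i j k → LeftOf j i l → OppositeSides i j k l
  oppositeSides {i} {j} {k} {l} k≢l lk@(leftOf lk′) rl@(leftOf rl′)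
    with sideOf k≢l (LeftOf⇒≢₁ lk) (LeftOf⇒≢₂ rl) | sideOf k≢l (LeftOf⇒≢₂ lk) (LeftOf⇒≢₁ rl)
  ... | inj₁ li | inj₁ lj = near-first li lj
  ... | inj₂ ri | inj₂ rj = near-second ri rj
  ... | inj₂ (leftOf ri) | inj₁ (leftOf lj) = crossing λ (disjoint ij⊥kl) →
    ij⊥kl (proj₂ (cross (point i) (point j) (point k) (point l) lk′ rl′ lj ri))
  ... | inj₁ (leftOf li) | inj₂ (leftOf rj) =
    ⊥-elim (¬cross-reversed (point i) (point j) (point k) (point l) lk′ rl′ li rj)

  opposite? : ∀ {i j k l} → k ≢ l → LeftOf i j k → LeftOf j i l → Dec (Disjoint i j k l)
  opposite? k≢l lk rl with oppositeSides k≢l lk rl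
  ... | crossing ¬ij⊥kl   = no ¬ij⊥kl
  ... | near-first li lj  = yes (Disjoint-sym (same-side li lj))
  ... | near-second ri rj = yes (Disjoint-sym (Disjoint-swap (same-side ri rj)))

  opposite⇒crossing : ConvexPosition P → ∀ {i j k l} → k ≢ l →
    LeftOf i j k → LeftOf j i l → ¬ Disjoint i j k l
  opposite⇒crossing convex {i} {j} {k} {l} k≢l lk rl with oppositeSides k≢l lk rl
  ... | crossing ¬ij⊥kl   = ¬ij⊥kl
  ... | near-first (leftOf li) (leftOf lj) = ⊥-elim (¬InTriangle P convex j k l i
    (proj₁ (non-crossing (point i) (point j) (point k) (point l) (isLeft lk) (isLeft rl)) li lj))
  ... | near-second (leftOf ri) (leftOf rj) = ⊥-elim (¬InTriangle P convex i l k j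
    (proj₂ (non-crossing (point i) (point j) (point k) (point l) (isLeft lk) (isLeft rl)) ri rj))

  -- Segments with a common endpoint meet. Otherwise `k` and `l` on one side of `ij` settle the
  -- matter, and only opposite sides call for the sides of `i` and `j` with respect to `kl`.
  disjoint? : ∀ {i j k l} → i ≢ j → k ≢ l → Dec (Disjoint i j k l)
  disjoint? {i} {j} {k} {l} i≢j k≢l with Other? i j k ×-dec Other? i j l
  ... | no  ¬others = no λ ij⊥kl → let (k∈ , l∈) = Disjoint⇒others ij⊥kl in
    ¬others (∈-others⁻ k∈ , ∈-others⁻ l∈)
  ... | yes ((k≢i , k≢j) , (l≢i , l≢j))
    with sideOf i≢j (≢-sym k≢i) (≢-sym k≢j) | sideOf i≢j (≢-sym l≢i) (≢-sym l≢j)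
  ...   | inj₁ lk | inj₁ ll = yes (same-side lk ll)
  ...   | inj₂ rk | inj₂ rl = yes (Disjoint-swap (same-side rk rl))
  ...   | inj₁ lk | inj₂ rl = opposite? k≢l lk rl
  ...   | inj₂ rk | inj₁ ll = map′ Disjoint-swap Disjoint-swap (opposite? k≢l rk ll)

  -- Neighbours and bounds on degrees

  vertices : List (Pair n)
  vertices = pairs allFin<

  -- Adjacency in `D P` in its wrapped form; edges that merely share an endpoint are excluded as
  -- well.
  Crossless : Pair n → Pair n → Set _
  Crossless (pair i j _) (pair k l _) = Disjoint i j k l

  Crossless? : ∀ e f → Dec (Crossless e f)
  Crossless? e@(pair i j _) f@(pair k l _) = disjoint? (lo≢hi e) (lo≢hi f)

  ∈-vertices : ∀ e → e ∈ₗ vertices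
  ∈-vertices e = ∈-pairs⁺ allFin< e (∈-allFin _) (∈-allFin _)

  neighbours : Pair n → List (Pair n)
  neighbours e = filter (Crossless? e) vertices

  unique-neighbours : ∀ e → Unique (neighbours e)
  unique-neighbours e = Unique.filter⁺ (Crossless? e) (unique-pairs allFin<)

  ∈-neighbours⁺ : ∀ {e f} → Crossless e f → f ∈ₗ neighbours e
  ∈-neighbours⁺ {e} {f} = ∈-filter⁺ (Crossless? e) (∈-vertices f)

  ∈-neighbours⁻ : ∀ {e f} → f ∈ₗ neighbours e → Crossless e f
  ∈-neighbours⁻ {e} f∈ = proj₂ (∈-filter⁻ (Crossless? e) {xs = vertices} f∈)

  deg : Pair n → ℕ
  deg e = length (neighbours e)

  degree : ∀ e → Degree (D P) e (deg e)
  degree e = neighbours e , unique-neighbours e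
    , (λ f → mk⇔ (λ f∈ {z} → segments⊥ (∈-neighbours⁻ {e} {f} f∈) {z})
        (λ e⊥f → ∈-neighbours⁺ {e} {f} (disjoint λ {z} → e⊥f {z}))) , refl

  sidePairs : Pair n → List (Pair n)
  sidePairs (pair i j _) = pairs (left< i j) ++ pairs (left< j i)

  sideCount : Fin n → Fin n → ℕ
  sideCount i j = length (left i j) C 2 + length (left j i) C 2

  length-sidePairs : ∀ e → length (sidePairs e) ≡ sideCount (Pair.lo e) (Pair.hi e)
  length-sidePairs (pair i j _) = trans (length-++ (pairs (left< i j)))
    (cong₂ _+_ (length-pairs (left< i j)) (length-pairs (left< j i)))

  unique-sidePairs : ∀ e → Unique (sidePairs e)
  unique-sidePairs (pair i j _) = Unique.++⁺ (unique-pairs (left< i j)) (unique-pairs (left< j i))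
    λ (f∈ˡ , f∈ʳ) → LeftOf-asym
      (∈-left⁻ (proj₁ (∈-pairs⁻ (left< i j) f∈ˡ))) (∈-left⁻ (proj₁ (∈-pairs⁻ (left< j i) f∈ʳ)))

  sidePairs⊆neighbours : ∀ e → sidePairs e ⊆ neighbours e
  sidePairs⊆neighbours e@(pair i j _) {f} f∈ with ∈-++⁻ (pairs (left< i j)) f∈
  ... | inj₁ f∈ˡ = let (k∈ , l∈) = ∈-pairs⁻ (left< i j) f∈ˡ in
    ∈-neighbours⁺ {e} {f} (same-side (∈-left⁻ k∈) (∈-left⁻ l∈))
  ... | inj₂ f∈ʳ = let (k∈ , l∈) = ∈-pairs⁻ (left< j i) f∈ʳ in
    ∈-neighbours⁺ {e} {f} (Disjoint-swap (same-side (∈-left⁻ k∈) (∈-left⁻ l∈)))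

  neighbours⊆sidePairs : ConvexPosition P → ∀ e → neighbours e ⊆ sidePairs e
  neighbours⊆sidePairs convex e@(pair i j _) {f@(pair k l _)} f∈
    with ij⊥kl ← ∈-neighbours⁻ {e} {f} f∈
    with (k≢i , k≢j) ← ∈-others⁻ (proj₁ (Disjoint⇒others ij⊥kl))
    with (l≢i , l≢j) ← ∈-others⁻ (proj₂ (Disjoint⇒others ij⊥kl))
    with sideOf (lo≢hi e) (≢-sym k≢i) (≢-sym k≢j) | sideOf (lo≢hi e) (≢-sym l≢i) (≢-sym l≢j)
  ... | inj₁ lk | inj₁ ll = ∈-++⁺ˡ (∈-pairs⁺ (left< i j) f (∈-left⁺ lk) (∈-left⁺ ll))
  ... | inj₂ rk | inj₂ rl =
    ∈-++⁺ʳ (pairs (left< i j)) (∈-pairs⁺ (left< j i) f (∈-left⁺ rk) (∈-left⁺ rl))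
  ... | inj₁ lk | inj₂ rl = ⊥-elim (opposite⇒crossing convex (lo≢hi f) lk rl ij⊥kl)
  ... | inj₂ rk | inj₁ ll =
    ⊥-elim (opposite⇒crossing convex (lo≢hi f) rk ll (Disjoint-swap ij⊥kl))

  sideCount≤deg : ∀ e → sideCount (Pair.lo e) (Pair.hi e) ≤ deg e
  sideCount≤deg e = subst (_≤ deg e) (length-sidePairs e)
    (unique⊆⇒length≤ (unique-sidePairs e) (sidePairs⊆neighbours e))

  deg≤sideCount : ConvexPosition P → ∀ e → deg e ≤ sideCount (Pair.lo e) (Pair.hi e)
  deg≤sideCount convex e = subst (deg e ≤_) (length-sidePairs e)
    (unique⊆⇒length≤ (unique-neighbours e) (neighbours⊆sidePairs convex e))

  κ≤deg : ∀ e → κ n ≤ deg e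
  κ≤deg e = ℕ.≤-trans
    (subst (λ m → κ m ≤ sideCount (Pair.lo e) (Pair.hi e)) (length-sides (lo≢hi e))
      (κ≤C₂+C₂ (length (left (Pair.lo e) (Pair.hi e))) _))
    (sideCount≤deg e)

  deg≤ : ∀ e → deg e ≤ (n ∸ 2) C 2
  deg≤ e@(pair i j _) = subst (deg e ≤_)
    (trans (length-pairs (others< i j)) (cong (λ m → (m ∸ 2) C 2) (length-others (lo≢hi e))))
    (unique⊆⇒length≤ (unique-neighbours e) λ {f} f∈ →
      let (k∈ , l∈) = Disjoint⇒others (∈-neighbours⁻ {e} {f} f∈) in ∈-pairs⁺ (others< i j) f k∈ l∈)

  edge : ∀ {i j} → i ≢ j → ∃[ e ] sideCount (Pair.lo e) (Pair.hi e) ≡ sideCount i j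
  edge {i} {j} i≢j with Fin.<-cmp i j
  ... | tri< i<j _ _ = pair i j i<j , refl
  ... | tri≈ _ i≡j _ = ⊥-elim (i≢j i≡j)
  ... | tri> _ _ j<i = pair j i j<i , ℕ.+-comm (length (left j i) C 2) _

  -- Edges at the lexicographically least point

  LexBefore : Fin n → Fin n → Set _
  LexBefore i j = LexPos (vec (point i) (point j))

  LeftOf-trans : ∀ {p i j k} → LexBefore p i → LexBefore p j → LexBefore p k →
    LeftOf p i j → LeftOf p j k → LeftOf p i k
  LeftOf-trans {p} {i} {j} {k} p<i p<j p<k (leftOf l) (leftOf m) =
    leftOf (Left-trans (point p) (point i) (point j) (point k) p<i p<j p<k l m)

  -- Seen from the lexicographically least point p, the other points are
  -- linearly ordered by angle, so the edges at p split them in every ratio.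
  edge-splitting : ∀ {p} → (∀ i → i ≢ p → LexBefore p i) → ∀ k → 2 + k ≤ n →
    ∃[ e ] sideCount (Pair.lo e) (Pair.hi e) ≡ k C 2 + (n ∸ 2 ∸ k) C 2
  edge-splitting {p} p-least k 2+k≤n =
    -- The order places `j` before `i` when `j` is to the left of the line from `p` to `i`, so the
    -- rank of `x` is the size of the left side of `p x`. This is the reverse of counterclockwise
    -- order, whence the exchanged arguments below.
    let (x , x∈ , rank≡k) = element-of-rank (λ j i → LeftOf? p i j) rest!
          (λ l → LeftOf⇒≢₂ l refl) total
          (λ x∈ y∈ z∈ l m →
            LeftOf-trans (p-least _ (≢p z∈)) (p-least _ (≢p y∈)) (p-least _ (≢p x∈)) m l)
          k<length
        (e , e≡) = edge (≢-sym (≢p x∈))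
    in e , trans e≡ (cong₂ (λ a b → a C 2 + b C 2) (left≡k x∈ rank≡k) (right≡ x∈ rank≡k))
    where
    Rest? : ∀ i → Dec (i ≢ p)
    Rest? i = ¬? (i Fin.≟ p)
    rest : List (Fin n)
    rest = filter Rest? (allFin n)
    rest! : Unique rest
    rest! = Unique.filter⁺ Rest? (sorted⇒unique allFin<)
    ≢p : ∀ {i} → i ∈ₗ rest → i ≢ p
    ≢p i∈ = proj₂ (∈-filter⁻ Rest? {xs = allFin n} i∈)
    ∈-rest⁺ : ∀ {i} → i ≢ p → i ∈ₗ rest
    ∈-rest⁺ = ∈-filter⁺ Rest? (∈-allFin _)
    total : ∀ {x y} → x ∈ₗ rest → y ∈ₗ rest → x ≢ y → LeftOf p y x ⊎ LeftOf p x y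
    total x∈ y∈ x≢y with sideOf x≢y (≢p x∈) (≢p y∈)
    ... | inj₁ l = inj₂ (LeftOf-rotate (LeftOf-rotate l))
    ... | inj₂ r = inj₁ (LeftOf-rotate (LeftOf-rotate r))
    cover : allFin n ⊆ p ∷ rest
    cover {i} _ with i Fin.≟ p
    ... | yes i≡p = here i≡p
    ... | no  i≢p = there (∈-rest⁺ i≢p)
    k<length : k < length rest
    k<length = ℕ.≤-pred (ℕ.≤-trans 2+k≤n
      (subst (_≤ suc (length rest)) (length-tabulate {n = n} (λ i → i))
        (unique⊆⇒length≤ (sorted⇒unique allFin<) cover)))
    -- `p` is not to the left of its own line `p x`, so filtering `rest` and filtering all points
    -- give the same count.
    left≡k : ∀ {x} → x ∈ₗ rest → length (filter (LeftOf? p x) rest) ≡ k → length (left p x) ≡ k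
    left≡k {x} x∈ = trans (unique⊆⊇⇒length≡
      (sorted⇒unique (left< p x)) (Unique.filter⁺ (LeftOf? p x) rest!)
      (λ i∈ → let l = ∈-left⁻ i∈ in ∈-filter⁺ (LeftOf? p x) (∈-rest⁺ (LeftOf⇒≢₁ l)) l)
      (λ i∈ → ∈-left⁺ (proj₂ (∈-filter⁻ (LeftOf? p x) {xs = rest} i∈))))
    right≡ : ∀ {x} → x ∈ₗ rest → length (filter (LeftOf? p x) rest) ≡ k →
      length (left x p) ≡ n ∸ 2 ∸ k
    right≡ {x} x∈ rank≡k = begin
      length (left x p)
        ≡⟨ ℕ.m+n∸m≡n k _ ⟨
      k + length (left x p) ∸ k
        ≡⟨ cong (λ m → m + length (left x p) ∸ k) (left≡k x∈ rank≡k) ⟨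
      length (left p x) + length (left x p) ∸ k
        ≡⟨ cong (λ m → m ∸ 2 ∸ k) (length-sides (≢-sym (≢p x∈))) ⟩
      n ∸ 2 ∸ k ∎
      where open ≡-Reasoning

  least-point : 1 ≤ n → ∃[ p ] (∀ i → i ≢ p → LexBefore p i)
  least-point (s≤s _) = minimum-exists
    (λ {i} {j} i≢j → LexPos-total (point i) (point j) (i≢j ∘ distinct))
    (λ {i} {j} {k} → LexPos-trans (point i) (point j) (point k))

  max-degree : 2 ≤ n → MaxDegree (D P) ((n ∸ 2) C 2)
  max-degree 2≤n =
    let (p , p-least) = least-point (ℕ.<⇒≤ 2≤n)
        (e , e≡)      = edge-splitting p-least 0 2≤n
        -- With one side empty, the pairs of the other side already number `(n ∸ 2) C 2`, so the
        -- bounds on `deg e` meet without convexity.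
        deg≡          = ℕ.≤-antisym (deg≤ e) (subst (_≤ deg e) e≡ (sideCount≤deg e))
    in (e , subst (Degree (D P) e) deg≡ (degree e)) , λ f → deg f , degree f , deg≤ f

  min-degree : 2 ≤ n → ∃[ δ ] MinDegree (D P) δ × κ n ≤ δ
  min-degree 2≤n = deg e , ((e , degree e) , λ f → deg f , degree f , deg-least f) , κ≤deg e
    where
    -- `argmin` takes a default element; the edge of maximum degree shows that there is one.
    e₀ : Pair n
    e₀ = proj₁ (proj₁ (max-degree 2≤n))
    e : Pair n
    e = Extrema.argmin deg e₀ vertices
    deg-least : ∀ f → deg e ≤ deg f
    deg-least f = All.lookup (Extrema.f[argmin]≤f[xs] {f = deg} e₀ vertices) (∈-vertices f)

  min-degree-convex : 2 ≤ n → ConvexPosition P → MinDegree (D P) (κ n)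
  min-degree-convex 2≤n convex =
    let (p , p-least) = least-point (ℕ.<⇒≤ 2≤n)
        h             = ⌊ n ∸ 2 /2⌋
        2+h≤n         = ℕ.≤-trans (ℕ.+-monoʳ-≤ 2 (ℕ.⌊n/2⌋≤n (n ∸ 2)))
                          (ℕ.≤-reflexive (ℕ.m+[n∸m]≡n 2≤n))
        (e , e≡)      = edge-splitting p-least h 2+h≤n
        rest≡         = trans (cong (_∸ h) (sym (ℕ.⌊n/2⌋+⌈n/2⌉≡n (n ∸ 2)))) (ℕ.m+n∸m≡n h _)
        sideCount≡κ   = trans e≡ (cong (λ m → h C 2 + m C 2) rest≡)
        deg≡          = ℕ.≤-antisym (subst (deg e ≤_) sideCount≡κ (deg≤sideCount convex e))
                          (κ≤deg e)
    in (e , subst (Degree (D P) e) deg≡ (degree e)) , λ f → deg f , degree f , κ≤deg f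

proposition1 : ∀ {c ℓ₁ ℓ₂} (F : OrderedField c ℓ₁ ℓ₂) → let open Plane F in
    ∀ n → 3 ≤ n → (P : PointSet n) → GeneralPosition P →
    (∃[ δ ] MinDegree (D P) δ × κ n ≤ δ)
    × MaxDegree (D P) ((n ∸ 2) C 2)
    × (ConvexPosition P → MinDegree (D P) (κ n))
proposition1 F n 3≤n P general = min-degree 2≤n , max-degree 2≤n , min-degree-convex 2≤n
  where
  open EdgeDisjointness F P general
  2≤n = ℕ.<⇒≤ 3≤n
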